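{- Let $\mathbb{F}$ be a field of characteristic $c$, let $M \in \mathbb{F}^{r \times n}$, and let $A,B \subseteq [n]$ with $|A|=|B|=r$. Let $X \subseteq A \setminus B$, $Y \subseteq B \setminus A$, and let $p$ be an integer with $|Y| \le p \le |X|$. Suppose that $c=0$ or $\binom{|X|-i}{|X|-p} \not\equiv 0 \pmod c$ for all $0 \le i \le |Y|$. Then $$\mu^M_{A, B}(\emptyset, \emptyset) = \sum_{k=0}^{|Y|} \sum_{i=0}^{|Y|-k} \frac{\binom{|X\cup Y|-|A\setminus B|-i-1}{|Y|-k-i}}{\binom{|X|-i}{|X|-p}} \sum_{\substack{U \subseteq A\setminus B,\ |U|=p+k,\ |U \cap X| = p \\ V \subseteq B\setminus A,\ |V|=p+k,\ Y \subseteq V}} \mu^M_{A, B}(U, V).$$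
   Context: $[n]=\{1,\dots,n\}$. For $J\subseteq[n]$, $M[J]$ is the submatrix of $M$ consisting of the columns indexed by $J$ in increasing order. For $A\subseteq[n]$, $X = \{x_1< \dotsb< x_k\} \subseteq A$ and $Y = \{y_1< \dotsb< y_k\} \subseteq [n] \setminus A$, $M[A; -X, +Y]$ denotes the matrix obtained from $M[A]$ by replacing, for each $i$, the column $x_i$ by the column $y_i$ (placed in the position of $x_i$); similarly, for $B\subseteq[n]$, $X\subseteq[n]\setminus B$, $Y\subseteq B$ with $|X|=|Y|$, $M[B; +X, -Y]$ is obtained from $M[B]$ by replacing column $y_i$ by column $x_i$ in the position of $y_i$. For $A,B$ with $|A|=|B|=r$, $X\subseteq A\setminus B$, $Y\subseteq B\setminus A$ with $|X|=|Y|$, define $\mu^M_{A,B}(X,Y) := \det M[A; -X, +Y]\cdot\det M[B; +X, -Y]$; so $\mu^M_{A,B}(\emptyset,\emptyset)=\det M[A]\det M[B]$. Binomial coefficients are generalized: for integers $n,k$, $\binom{n}{k} = n(n-1)\cdots(n-k+1)/k!$ if $k\ge 0$ and $0$ if $k<0$ (so $n$ may be negative); rational coefficients are interpreted in $\mathbb{F}$. -}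

module Defs where

open import Level using (Level; _⊔_) renaming (suc to lsuc)
open import Algebra.Bundles using (CommutativeRing)
open import Data.Nat using (ℕ; zero; suc; _∸_) renaming (_+_ to _+ℕ_)
open import Data.Nat.Combinatorics using (_C_)
open import Data.Nat.Divisibility using (_∣_)
open import Data.Integer using (ℤ; +_; -[1+_]) renaming (_*_ to _*ℤ_; -_ to -ℤ_; _-_ to _-ℤ_)
open import Data.Fin using (Fin; zero; suc)
open import Data.Fin.Subset using (Subset; inside; outside; _⊆_; _─_; _∩_; _∪_; ∣_∣)
open import Data.Fin.Subset.Properties using (_⊆?_)
open import Data.List using (List; []; _∷_; _++_; [_]; map; foldr; upTo)
open import Data.Vec using (Vec; []; _∷_)
open import Data.Bool using (Bool; true; false; if_then_else_; _∧_)
open import Data.Product using (_×_)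
open import Relation.Nullary using (¬_)
open import Relation.Nullary.Decidable using (⌊_⌋)

-- Fields: a commutative ring with 0 ≠ 1 in which every nonzero element
-- has a multiplicative inverse (the inverse map is total; its value at 0
-- is irrelevant).

record Field (a ℓ : Level) : Set (lsuc (a ⊔ ℓ)) where
  field
    commutativeRing : CommutativeRing a ℓ
  open CommutativeRing commutativeRing public
  field
    _⁻¹        : Carrier → Carrier
    ⁻¹-inverse : ∀ x → ¬ (x ≈ 0#) → (x * (x ⁻¹)) ≈ 1#
    0≉1        : ¬ (0# ≈ 1#)

-- Generalized binomial coefficient  binom(n,k) for n ∈ ℤ, k ≥ 0
-- (= n(n-1)...(n-k+1)/k!).  For n = -(m+1) < 0 this equals
-- (-1)^k * binom(k+m, k), which is how it is computed here.

negOnePow : ℕ → ℤ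
negOnePow zero    = + 1
negOnePow (suc k) = -ℤ (negOnePow k)

gbinom : ℤ → ℕ → ℤ
gbinom (+ m)      k = + (m C k)
gbinom (-[1+ m ]) k = negOnePow k *ℤ (+ ((k +ℕ m) C k))

allSubsets : (n : ℕ) → List (Subset n)
allSubsets zero    = [] ∷ []
allSubsets (suc n) = map (inside ∷_) (allSubsets n) ++ map (outside ∷_) (allSubsets n)

elems : ∀ {n} → Subset n → List (Fin n)
elems []            = []
elems (inside ∷ s)  = zero ∷ map suc (elems s)
elems (outside ∷ s) = map suc (elems s)

-- replace as xs ys : walk through the increasing list as; whenever the
-- current element is the i-th element x_i of the increasing list xs, put
-- y_i (the i-th element of ys) in its place.  For X ⊆ A this yields the
-- column list of M[A; -X, +Y].
replace : ∀ {n} → List (Fin n) → List (Fin n) → List (Fin n) → List (Fin n)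
replace []       _        _        = []
replace (a ∷ as) []       _        = a ∷ as
replace (a ∷ as) (x ∷ xs) []       = a ∷ as
replace (a ∷ as) (x ∷ xs) (y ∷ ys) =
  if ⌊ a Data.Fin.≟ x ⌋ then y ∷ replace as xs ys else a ∷ replace as (x ∷ xs) (y ∷ ys)

module FieldOps {a ℓ : Level} (F : Field a ℓ) where
  open Field F hiding (zero)

  Σ : ∀ {b} {I : Set b} → List I → (I → Carrier) → Carrier
  Σ xs f = foldr (λ x acc → f x + acc) 0# xs

  ℕ→F : ℕ → Carrier
  ℕ→F zero    = 0#
  ℕ→F (suc m) = 1# + ℕ→F m

  ℤ→F : ℤ → Carrier
  ℤ→F (+ m)      = ℕ→F m
  ℤ→F (-[1+ m ]) = - ℕ→F (suc m)

  HasCharacteristic : ℕ → Set ℓ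
  HasCharacteristic c = ∀ m → (ℕ→F m ≈ 0# → c ∣ m) × (c ∣ m → ℕ→F m ≈ 0#)

  -- Determinant of the r×r matrix whose columns are given by a list
  -- (Laplace expansion along the first row); the list is expected to have
  -- length r (otherwise the value is 0, irrelevant here).
  detL : (r : ℕ) → List (Fin r → Carrier) → Carrier
  detL zero    []      = 1#
  detL zero    (_ ∷ _) = 0#
  detL (suc r) cs      = expand [] cs 1#
    where
    expand : List (Fin (suc r) → Carrier) → List (Fin (suc r) → Carrier) → Carrier → Carrier
    expand pre []         s = 0#
    expand pre (col ∷ post) s =
      (s * col zero) * detL r (map (λ d i → d (suc i)) (pre ++ post))
      + expand (pre ++ [ col ]) post (- s)

  colsOf : ∀ {r n} → (Fin r → Fin n → Carrier) → List (Fin n) → List (Fin r → Carrier)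
  colsOf M js = map (λ j i → M i j) js

  μ : ∀ {r n} → (Fin r → Fin n → Carrier) → (A B X Y : Subset n) → Carrier
  μ {r} M A B X Y =
    detL r (colsOf M (replace (elems A) (elems X) (elems Y)))
    * detL r (colsOf M (replace (elems B) (elems Y) (elems X)))

  rhs : ∀ {r n} → (Fin r → Fin n → Carrier) → (A B X Y : Subset n) → ℕ → Carrier
  rhs {r} {n} M A B X Y p =
    Σ (upTo (suc ∣ Y ∣)) λ k →
    Σ (upTo (suc (∣ Y ∣ ∸ k))) λ i →
      (ℤ→F (gbinom (+ ∣ X ∪ Y ∣ -ℤ + ∣ A ─ B ∣ -ℤ + i -ℤ + 1) (∣ Y ∣ ∸ k ∸ i))
        * (ℕ→F ((∣ X ∣ ∸ i) C (∣ X ∣ ∸ p)) ⁻¹))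
      * (Σ (allSubsets n) λ U → Σ (allSubsets n) λ V →
           if ⌊ U ⊆? (A ─ B) ⌋ ∧ ⌊ ∣ U ∣ Data.Nat.≟ (p +ℕ k) ⌋ ∧ ⌊ ∣ U ∩ X ∣ Data.Nat.≟ p ⌋
              ∧ ⌊ V ⊆? (B ─ A) ⌋ ∧ ⌊ ∣ V ∣ Data.Nat.≟ (p +ℕ k) ⌋ ∧ ⌊ Y ⊆? V ⌋
           then μ M A B U V else 0#)

{-# OPTIONS --safe #-}
module Submission where

-- For U ⊆ A ─ B and Y ⊆ B ─ A one has the exchange identity
--     Σ { μ(U, V) : Y ⊆ V ⊆ B ─ A, |V| = |U| } = Σ { μ(W, Y) : W ⊆ U, |W| = |Y| }.
-- By Laplace expansion along the first r rows, both sides are, up to sign, determinants of 2r × 2r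
-- matrices whose columns are pairs (t, b) of vectors: a column (t, 0) belongs to the first factor,
-- (0, b) to the second, and (v, v) is summed over both possibilities. On the right, the columns of
-- B ─ Y are (v, 0), those of Y and A ─ U are (0, v) and those of U are (v, v). The map
-- (t, b) ↦ (t − b, t), of determinant 1, turns this up to signs into the matrix of the left, in which
-- the columns of A ─ U and Y are (v, 0), those of U are (0, v) and those of B ─ Y are (v, v); there,
-- the terms with V ⊈ B ─ A vanish because a column is repeated.
-- Applied to the sum over V in the theorem, the identity turns the right-hand side into a combination
-- of the μ(W, Y) with W ⊆ A ─ B, |W| = |Y|. The coefficient of μ(W, Y), a weighted count of the sets
-- U ⊇ W, equals 1 by the Chu–Vandermonde identity, and Σ_W μ(W, Y) = μ(∅, ∅) by two more applications
-- of the identity, with U = A ─ B.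

open import Defs
open import Level using (Level; _⊔_)
open import Algebra.Bundles using (CommutativeRing)
open import Data.Nat using (ℕ; zero; suc; _≤_; _<_; _∸_; _≡ᵇ_; z<s; s<s; s≤s; s≤s⁻¹)
open import Data.Nat.Combinatorics using (_C_; nCk≡nC[n∸k]; nCk+nC[k+1]≡[n+1]C[k+1]; k>n⇒nCk≡0)
open import Data.Nat.Divisibility using (_∣_; 0∣⇒≡0)
import Data.Nat as ℕ
import Data.Nat.Properties as ℕ
open import Data.Integer as ℤ using (ℤ; +_; -[1+_])
import Data.Integer.Properties as ℤ
open import Data.Fin using (Fin; zero; suc)
import Data.Fin.Properties as Fin
open import Data.Fin.Subset using (Subset; inside; outside; _⊆_; _─_; _∩_; _∪_; ∁; ∣_∣; ⊥)
open import Data.Fin.Subset.Properties using (_⊆?_; p─q⊆p; ⊆-refl; ⊥⊆; ∣⊥∣≡0; p⊆q⇒∣p∣≤∣q∣; ∩-comm)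
open import Data.Bool using (Bool; true; false; if_then_else_; _∧_; not; T)
open import Data.Bool.Properties using (∧-zeroʳ; ∧-identityʳ)
open import Data.Unit using (tt)
open import Data.List using (List; []; _∷_; [_]; _++_; map; length; upTo; applyUpTo)
open import Data.List.Properties using (++-assoc; ++-identityʳ; map-++; map-∘; map-id; length-map)
open import Data.List.Relation.Binary.Pointwise using (Pointwise; []; _∷_)
open import Data.List.Relation.Unary.All using (All; []; _∷_)
open import Data.Vec using ([]; _∷_; lookup)
open import Data.Vec.Properties using (lookup-replicate; lookup-map)
open import Data.Maybe using (nothing)
open import Data.Product using (∃; ∃₂; _×_; _,_; proj₁; proj₂)
open import Data.Sum using (_⊎_; inj₁; inj₂)
open import Function using (_∘_; id)
open import Relation.Binary.Definitions using (tri<; tri≈; tri>)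
open import Relation.Binary.PropositionalEquality as ≡ using (_≡_; _≢_)
open import Relation.Nullary using (¬_; does; yes; no; contradiction)
open import Relation.Nullary.Decidable using (⌊_⌋; dec-true; isYes≗does)
open import Tactic.RingSolver using (solve-∀)
open import Tactic.RingSolver.Core.AlmostCommutativeRing using (AlmostCommutativeRing; fromCommutativeRing)
import Data.Nat.Tactic.RingSolver as ℕ-RingSolver
import Data.Integer.Tactic.RingSolver as ℤ-RingSolver

-- For fixed W put j = |W ∩ X|, w = |W ─ X| and m = |(A ─ B) ─ (X ∪ W)|. The sets U ⊇ W with |U ∩ X|
-- = p and |U ─ X| = k number binom(|X| - j, p - j) · binom(m, k - w), and the upper index |X ∪ Y| -
-- |A ─ B| - i - 1 of the theorem equals j - m - i - 1. Summed over k at fixed i, Vandermonde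
-- cancels m and leaves binom(j - i - 1, j - i), which is 1 for i = j and 0 for every other i. The
-- numerators thus detect j: they select the one denominator binom(|X| - j, |X| - p), and this is
-- the first factor of the count. Since j varies with W, different W call for different
-- denominators. In the exchange identity the obstacle is the sign. Determinants are treated as
-- alternating forms on lists of columns, every rearrangement contributes a natural exponent of -1,
-- and only the total parity is evaluated. Containments such as Y ⊆ V are imposed by zeroing one
-- component of a column, so that one Laplace expansion serves both sides.

-- The number of k-element sets that contain f given elements and otherwise consist of some of m
-- further ones.
supersets : (m f k : ℕ) → ℕ
supersets m zero    k       = m C k
supersets m (suc f) zero    = 0
supersets m (suc f) (suc k) = supersets m f k

-- An additional element is either left out or joins the prescribed ones. This form of Pascal's rule
-- needs no subtraction in `k`.
supersets-suc : ∀ m f k → supersets (suc m) f k ≡ supersets m f k ℕ.+ supersets m (suc f) k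
supersets-suc m zero    zero    = ≡.refl
supersets-suc m zero    (suc k) = ≡.trans (≡.sym (nCk+nC[k+1]≡[n+1]C[k+1] m k)) (ℕ.+-comm (m C k) _)
supersets-suc m (suc f) zero    = ≡.refl
supersets-suc m (suc f) (suc k) = supersets-suc m f k

supersets-+ : ∀ m f k → supersets m f (f ℕ.+ k) ≡ m C k
supersets-+ m zero    k = ≡.refl
supersets-+ m (suc f) k = supersets-+ m f k

C-positive : ∀ n k → k ≤ n → n C k ≢ 0
C-positive n       zero    _ ()
C-positive (suc n) (suc k) (s≤s k≤n) eq =
  C-positive n k k≤n (ℕ.m+n≡0⇒m≡0 (n C k) (≡.trans (nCk+nC[k+1]≡[n+1]C[k+1] n k) eq))

-- Column lists indexed by subsets

infix 7 _⊆ᵇ_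
_⊆ᵇ_ : ∀ {n} → Subset n → Subset n → Bool
p ⊆ᵇ q = does (p ⊆? q)

-- The reindexing by `suc` goes into `h` instead of the list, so that statements about column lists
-- are structural inductions on the subset.
pick : ∀ {x} {X : Set x} {n} → Subset n → (Fin n → X) → List X
pick []            h = []
pick (inside ∷ S)  h = h zero ∷ pick S (h ∘ suc)
pick (outside ∷ S) h = pick S (h ∘ suc)

-- The structurally recursive counterpart of replace; the value is junk if ws is shorter than U.
substitute : ∀ {x} {X : Set x} {n} (A U : Subset n) → (Fin n → X) → List X → List X
substitute []            []            h ws       = []
substitute (outside ∷ A) (_ ∷ U)       h ws       = substitute A U (h ∘ suc) ws
substitute (inside ∷ A)  (outside ∷ U) h ws       = h zero ∷ substitute A U (h ∘ suc) ws
substitute (inside ∷ A)  (inside ∷ U)  h []       = h zero ∷ substitute A U (h ∘ suc) []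
substitute (inside ∷ A)  (inside ∷ U)  h (w ∷ ws) = w ∷ substitute A U (h ∘ suc) ws

map-elems : ∀ {x} {X : Set x} {n} (S : Subset n) (h : Fin n → X) → map h (elems S) ≡ pick S h
map-elems []            h = ≡.refl
map-elems (inside ∷ S)  h = ≡.cong (h zero ∷_) (≡.trans (≡.sym (map-∘ (elems S))) (map-elems S (h ∘ suc)))
map-elems (outside ∷ S) h = ≡.trans (≡.sym (map-∘ (elems S))) (map-elems S (h ∘ suc))

length-pick : ∀ {x} {X : Set x} {n} (S : Subset n) (h : Fin n → X) → length (pick S h) ≡ ∣ S ∣
length-pick []            h = ≡.refl
length-pick (inside ∷ S)  h = ≡.cong suc (length-pick S (h ∘ suc))
length-pick (outside ∷ S) h = length-pick S (h ∘ suc)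

map-pick : ∀ {x y} {X : Set x} {Y : Set y} (k : X → Y) {n} (S : Subset n) (h : Fin n → X) →
  map k (pick S h) ≡ pick S (k ∘ h)
map-pick k []            h = ≡.refl
map-pick k (inside ∷ S)  h = ≡.cong (k (h zero) ∷_) (map-pick k S (h ∘ suc))
map-pick k (outside ∷ S) h = map-pick k S (h ∘ suc)

pick-pointwise : ∀ {x s} {X : Set x} {R : X → X → Set s} {n} (S : Subset n) {h k : Fin n → X} →
  (∀ j → lookup S j ≡ inside → R (h j) (k j)) → Pointwise R (pick S h) (pick S k)
pick-pointwise []            r = []
pick-pointwise (inside ∷ S)  r = r zero ≡.refl ∷ pick-pointwise S (r ∘ suc)
pick-pointwise (outside ∷ S) r = pick-pointwise S (r ∘ suc)

substitute-self : ∀ {x} {X : Set x} {n} (A U : Subset n) (h : Fin n → X) → U ⊆ᵇ A ≡ true →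
  substitute A U h (pick U h) ≡ pick A h
substitute-self []            []            h p = ≡.refl
substitute-self (inside ∷ A)  (inside ∷ U)  h p = ≡.cong (h zero ∷_) (substitute-self A U (h ∘ suc) p)
substitute-self (inside ∷ A)  (outside ∷ U) h p = ≡.cong (h zero ∷_) (substitute-self A U (h ∘ suc) p)
substitute-self (outside ∷ A) (outside ∷ U) h p = substitute-self A U (h ∘ suc) p

∣p─q∣+∣q∣≡∣p∣ : ∀ {n} (p q : Subset n) → q ⊆ᵇ p ≡ true → ∣ p ─ q ∣ ℕ.+ ∣ q ∣ ≡ ∣ p ∣
∣p─q∣+∣q∣≡∣p∣ []            []            _ = ≡.refl
∣p─q∣+∣q∣≡∣p∣ (inside ∷ p)  (inside ∷ q)  s = ≡.trans (ℕ.+-suc _ _) (≡.cong suc (∣p─q∣+∣q∣≡∣p∣ p q s))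
∣p─q∣+∣q∣≡∣p∣ (inside ∷ p)  (outside ∷ q) s = ≡.cong suc (∣p─q∣+∣q∣≡∣p∣ p q s)
∣p─q∣+∣q∣≡∣p∣ (outside ∷ p) (outside ∷ q) s = ∣p─q∣+∣q∣≡∣p∣ p q s

-- The number of pairs u < a with u ∈ U and a ∈ A ─ U.
inversions : ∀ {n} → Subset n → Subset n → ℕ
inversions []           []            = 0
inversions (_ ∷ A)      (outside ∷ U) = inversions A U
inversions (_ ∷ A)      (inside ∷ U)  = ∣ A ─ U ∣ ℕ.+ inversions A U

-- Agreement of `substitute` with `replace`

∧-true : ∀ {b c} → b ∧ c ≡ true → b ≡ true × c ≡ true
∧-true {true} {true} _ = ≡.refl , ≡.refl

≡ᵇ-true : ∀ {m n} → (m ≡ᵇ n) ≡ true → m ≡ n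
≡ᵇ-true {m} {n} p = ℕ.≡ᵇ⇒≡ m n (≡.subst T (≡.sym p) tt)

elems≡pick : ∀ {n} (S : Subset n) → elems S ≡ pick S id
elems≡pick S = ≡.trans (≡.sym (map-id (elems S))) (map-elems S id)

replace-[] : ∀ {n} (as ys : List (Fin n)) → replace as [] ys ≡ as
replace-[] []      ys = ≡.refl
replace-[] (_ ∷ _) ys = ≡.refl

replace-miss : ∀ {n} (a : Fin n) as {xs} ys → All (a ≢_) xs → replace (a ∷ as) xs ys ≡ a ∷ replace as xs ys
replace-miss a as ys       []       = ≡.cong (a ∷_) (≡.sym (replace-[] as ys))
replace-miss a []       []       (_ ∷ _)  = ≡.refl
replace-miss a (_ ∷ _)  []       (_ ∷ _)  = ≡.refl
replace-miss a as {x ∷ _} (_ ∷ _) (p ∷ _) with a Fin.≟ x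
... | yes eq = contradiction eq p
... | no _   = ≡.refl

All-pick : ∀ {x p} {X : Set x} {P : X → Set p} {n} (S : Subset n) {h : Fin n → X} → (∀ j → P (h j)) → All P (pick S h)
All-pick []            p = []
All-pick (inside ∷ S)  p = p zero ∷ All-pick S (p ∘ suc)
All-pick (outside ∷ S) p = All-pick S (p ∘ suc)

-- `replace` compares elements of one fixed `Fin N`, whereas `substitute` descends to smaller index
-- types; the embedding `e` connects the two. Its injectivity shows that a kept element differs from
-- all later elements to be replaced.
replace-pick : ∀ {x} {X : Set x} {n N} (A U : Subset n) (e : Fin n → Fin N) (h : Fin N → X) ys →
  (∀ {i j} → e i ≡ e j → i ≡ j) → U ⊆ᵇ A ≡ true → length ys ≡ ∣ U ∣ →
  map h (replace (pick A e) (pick U e) ys) ≡ substitute A U (h ∘ e) (map h ys)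
replace-pick []            []            e h []       inj p q = ≡.refl
replace-pick (outside ∷ A) (outside ∷ U) e h ys       inj p q = replace-pick A U (e ∘ suc) h ys (Fin.suc-injective ∘ inj) p q
replace-pick (inside ∷ A)  (outside ∷ U) e h ys       inj p q = ≡.trans
  (≡.cong (map h) (replace-miss (e zero) (pick A (e ∘ suc)) ys (All-pick U λ j eq → contradiction (inj eq) λ ())))
  (≡.cong (h (e zero) ∷_) (replace-pick A U (e ∘ suc) h ys (Fin.suc-injective ∘ inj) p q))
replace-pick (inside ∷ A)  (inside ∷ U)  e h (y ∷ ys) inj p q with e zero Fin.≟ e zero
... | yes _ = ≡.cong (h y ∷_) (replace-pick A U (e ∘ suc) h ys (Fin.suc-injective ∘ inj) p (ℕ.suc-injective q))
... | no ne = contradiction ≡.refl ne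

-- Containment constraints encoded by a null column

module _ {x} {X : Set x} (z : X) where

  -- With `z` the zero column, a determinant that receives a clipped column vanishes; a condition on
  -- the chosen set thereby becomes a property of the columns.
  clip : ∀ {n} → Subset n → (Fin n → X) → Fin n → X
  clip S h j = if lookup S j then h j else z

  pick-clip : ∀ {n} (V S : Subset n) h → V ⊆ᵇ S ≡ true → pick V (clip S h) ≡ pick V h
  pick-clip []            []           h p = ≡.refl
  pick-clip (outside ∷ V) (_ ∷ S)      h p = pick-clip V S (h ∘ suc) p
  pick-clip (inside ∷ V)  (inside ∷ S) h p = ≡.cong (h zero ∷_) (pick-clip V S (h ∘ suc) p)

  -- Only elements outside `V` keep their own column, and none of them lies in `S`.
  substitute-clip : ∀ {n} (B V S : Subset n) h ws → V ⊆ᵇ B ≡ true → S ⊆ᵇ V ≡ true → length ws ≡ ∣ V ∣ →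
    substitute B V (clip (∁ S) h) ws ≡ substitute B V h ws
  substitute-clip []            []            []            h ws       o p q = ≡.refl
  substitute-clip (inside ∷ B)  (outside ∷ V) (outside ∷ S) h ws       o p q = ≡.cong (h zero ∷_) (substitute-clip B V S (h ∘ suc) ws o p q)
  substitute-clip (outside ∷ B) (outside ∷ V) (outside ∷ S) h ws       o p q = substitute-clip B V S (h ∘ suc) ws o p q
  substitute-clip (inside ∷ B)  (inside ∷ V)  (inside ∷ S)  h (w ∷ ws) o p q = ≡.cong (w ∷_) (substitute-clip B V S (h ∘ suc) ws o p (ℕ.suc-injective q))
  substitute-clip (inside ∷ B)  (inside ∷ V)  (outside ∷ S) h (w ∷ ws) o p q = ≡.cong (w ∷_) (substitute-clip B V S (h ∘ suc) ws o p (ℕ.suc-injective q))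

-- Membership, inclusion and cardinality of subsets

lookup-─ : ∀ {n} (p q : Subset n) j → lookup (p ─ q) j ≡ inside → lookup p j ≡ inside × lookup q j ≡ outside
lookup-─ (x ∷ p) (outside ∷ q) zero    eq = eq , ≡.refl
lookup-─ (_ ∷ p) (_ ∷ q)       (suc j) eq = lookup-─ p q j eq

⊆ᵇ-lookup : ∀ {n} (p q : Subset n) j → p ⊆ᵇ q ≡ true → lookup p j ≡ inside → lookup q j ≡ inside
⊆ᵇ-lookup (inside ∷ p)  (inside ∷ q) zero    s eq = ≡.refl
⊆ᵇ-lookup (outside ∷ p) (_ ∷ q)      (suc j) s eq = ⊆ᵇ-lookup p q j s eq
⊆ᵇ-lookup (inside ∷ p)  (inside ∷ q) (suc j) s eq = ⊆ᵇ-lookup p q j s eq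

⊆ᵇ-sound : ∀ {n} (p q : Subset n) → p ⊆ᵇ q ≡ true → p ⊆ q
⊆ᵇ-sound p q eq with p ⊆? q
... | yes s = s

⊆ᵇ-complete : ∀ {n} (p q : Subset n) → p ⊆ q → p ⊆ᵇ q ≡ true
⊆ᵇ-complete p q = dec-true (p ⊆? q)

⊆ᵇ-trans : ∀ {n} (p q r : Subset n) → p ⊆ᵇ q ≡ true → q ⊆ᵇ r ≡ true → p ⊆ᵇ r ≡ true
⊆ᵇ-trans p q r s t = ⊆ᵇ-complete p r λ x → ⊆ᵇ-sound q r t (⊆ᵇ-sound p q s x)

⊥⊆ᵇ : ∀ {n} (p : Subset n) → ⊥ ⊆ᵇ p ≡ true
⊥⊆ᵇ p = ⊆ᵇ-complete ⊥ p ⊥⊆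

─⊆ᵇ : ∀ {n} (p q : Subset n) → (p ─ q) ⊆ᵇ p ≡ true
─⊆ᵇ p q = ⊆ᵇ-complete (p ─ q) p (p─q⊆p p q)

meets-removed : ∀ {n} (V A B : Subset n) → V ⊆ᵇ B ≡ true → V ⊆ᵇ (B ─ A) ≡ false →
  ∃ λ j → lookup V j ≡ inside × lookup A j ≡ inside × lookup B j ≡ inside
meets-removed []            []            []           _ ()
meets-removed (outside ∷ V) (_ ∷ A)       (_ ∷ B)      p q = let j , r = meets-removed V A B p q in suc j , r
meets-removed (inside ∷ V)  (inside ∷ A)  (inside ∷ B) p q = zero , ≡.refl , ≡.refl , ≡.refl
meets-removed (inside ∷ V)  (outside ∷ A) (inside ∷ B) p q = let j , r = meets-removed V A B p q in suc j , r

lookup-─⁺ : ∀ {n} (p q : Subset n) j → lookup p j ≡ inside → lookup q j ≢ inside → lookup (p ─ q) j ≡ inside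
lookup-─⁺ (_ ∷ p) (inside ∷ q)  zero    s t = contradiction ≡.refl t
lookup-─⁺ (_ ∷ p) (outside ∷ q) zero    s t = s
lookup-─⁺ (_ ∷ p) (_ ∷ q)       (suc j) s t = lookup-─⁺ p q j s t

pick-split : ∀ {x} {X : Set x} {n} (S : Subset n) (h : Fin n → X) j → lookup S j ≡ inside →
  ∃₂ λ pre post → pick S h ≡ pre ++ h j ∷ post
pick-split (inside ∷ S)  h zero    eq = [] , pick S (h ∘ suc) , ≡.refl
pick-split (inside ∷ S)  h (suc j) eq =
  let pre , post , e = pick-split S (h ∘ suc) j eq in h zero ∷ pre , post , ≡.cong (h zero ∷_) e
pick-split (outside ∷ S) h (suc j) eq = pick-split S (h ∘ suc) j eq

∣p∩q∣+∣p─q∣≡∣p∣ : ∀ {n} (p q : Subset n) → ∣ p ∩ q ∣ ℕ.+ ∣ p ─ q ∣ ≡ ∣ p ∣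
∣p∩q∣+∣p─q∣≡∣p∣ []            []            = ≡.refl
∣p∩q∣+∣p─q∣≡∣p∣ (outside ∷ p) (inside ∷ q)  = ∣p∩q∣+∣p─q∣≡∣p∣ p q
∣p∩q∣+∣p─q∣≡∣p∣ (outside ∷ p) (outside ∷ q) = ∣p∩q∣+∣p─q∣≡∣p∣ p q
∣p∩q∣+∣p─q∣≡∣p∣ (inside ∷ p)  (inside ∷ q)  = ≡.cong suc (∣p∩q∣+∣p─q∣≡∣p∣ p q)
∣p∩q∣+∣p─q∣≡∣p∣ (inside ∷ p)  (outside ∷ q) = ≡.trans (ℕ.+-suc _ _) (≡.cong suc (∣p∩q∣+∣p─q∣≡∣p∣ p q))

∣p∪q∣-disjoint : ∀ {n} (p q A B : Subset n) → p ⊆ᵇ (A ─ B) ≡ true → q ⊆ᵇ (B ─ A) ≡ true → ∣ p ∪ q ∣ ≡ ∣ p ∣ ℕ.+ ∣ q ∣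
∣p∪q∣-disjoint []            []            []            []            s t = ≡.refl
∣p∪q∣-disjoint (outside ∷ p) (outside ∷ q) (_ ∷ A)       (_ ∷ B)       s t = ∣p∪q∣-disjoint p q A B s t
∣p∪q∣-disjoint (inside ∷ p)  (outside ∷ q) (inside ∷ A)  (outside ∷ B) s t = ≡.cong suc (∣p∪q∣-disjoint p q A B s t)
∣p∪q∣-disjoint (outside ∷ p) (inside ∷ q)  (outside ∷ A) (inside ∷ B)  s t =
  ≡.trans (≡.cong suc (∣p∪q∣-disjoint p q A B s t)) (≡.sym (ℕ.+-suc _ _))

∣D∣-split : ∀ {n} (D X W : Subset n) → X ⊆ᵇ D ≡ true → W ⊆ᵇ D ≡ true → ∣ D ∣ ≡ ∣ X ∣ ℕ.+ ∣ W ─ X ∣ ℕ.+ ∣ (D ─ X) ─ W ∣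
∣D∣-split []            []            []            s t = ≡.refl
∣D∣-split (outside ∷ D) (outside ∷ X) (outside ∷ W) s t = ∣D∣-split D X W s t
∣D∣-split (inside ∷ D)  (inside ∷ X)  (inside ∷ W)  s t = ≡.cong suc (∣D∣-split D X W s t)
∣D∣-split (inside ∷ D)  (inside ∷ X)  (outside ∷ W) s t = ≡.cong suc (∣D∣-split D X W s t)
∣D∣-split (inside ∷ D)  (outside ∷ X) (inside ∷ W)  s t =
  ≡.trans (≡.cong suc (∣D∣-split D X W s t)) (≡.cong (ℕ._+ ∣ (D ─ X) ─ W ∣) (≡.sym (ℕ.+-suc ∣ X ∣ _)))
∣D∣-split (inside ∷ D)  (outside ∷ X) (outside ∷ W) s t =
  ≡.trans (≡.cong suc (∣D∣-split D X W s t)) (≡.sym (ℕ.+-suc (∣ X ∣ ℕ.+ ∣ W ─ X ∣) _))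

∣A─B∣+∣B∣≡∣B─A∣+∣A∣ : ∀ {n} (A B : Subset n) → ∣ A ─ B ∣ ℕ.+ ∣ B ∣ ≡ ∣ B ─ A ∣ ℕ.+ ∣ A ∣
∣A─B∣+∣B∣≡∣B─A∣+∣A∣ []            []            = ≡.refl
∣A─B∣+∣B∣≡∣B─A∣+∣A∣ (inside ∷ A)  (inside ∷ B)  = ≡.trans (ℕ.+-suc _ _) (≡.trans (≡.cong suc (∣A─B∣+∣B∣≡∣B─A∣+∣A∣ A B)) (≡.sym (ℕ.+-suc _ _)))
∣A─B∣+∣B∣≡∣B─A∣+∣A∣ (inside ∷ A)  (outside ∷ B) = ≡.trans (≡.cong suc (∣A─B∣+∣B∣≡∣B─A∣+∣A∣ A B)) (≡.sym (ℕ.+-suc _ _))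
∣A─B∣+∣B∣≡∣B─A∣+∣A∣ (outside ∷ A) (inside ∷ B)  = ≡.trans (ℕ.+-suc _ _) (≡.cong suc (∣A─B∣+∣B∣≡∣B─A∣+∣A∣ A B))
∣A─B∣+∣B∣≡∣B─A∣+∣A∣ (outside ∷ A) (outside ∷ B) = ∣A─B∣+∣B∣≡∣B─A∣+∣A∣ A B

⊆ᵇ-antisym-size : ∀ {n} (p q : Subset n) → p ⊆ᵇ q ≡ true → ∣ p ∣ ≡ ∣ q ∣ → p ≡ q
⊆ᵇ-antisym-size []            []            s e = ≡.refl
⊆ᵇ-antisym-size (inside ∷ p)  (inside ∷ q)  s e = ≡.cong (inside ∷_) (⊆ᵇ-antisym-size p q s (ℕ.suc-injective e))
⊆ᵇ-antisym-size (outside ∷ p) (outside ∷ q) s e = ≡.cong (outside ∷_) (⊆ᵇ-antisym-size p q s e)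
⊆ᵇ-antisym-size (outside ∷ p) (inside ∷ q)  s e =
  contradiction (p⊆q⇒∣p∣≤∣q∣ (⊆ᵇ-sound p q s)) (ℕ.<⇒≱ (ℕ.≤-reflexive (≡.sym e)))

≡ᵇ-+ : ∀ a b k → (a ℕ.+ b ≡ᵇ a ℕ.+ k) ≡ (b ≡ᵇ k)
≡ᵇ-+ zero    b k = ≡.refl
≡ᵇ-+ (suc a) b k = ≡ᵇ-+ a b k

-- The theorem prescribes |U| and |U ∩ X|; prescribing the sizes inside and outside `X` instead
-- makes the two choices independent, so that the count of the U is a product.
split-size : ∀ {n} (U X : Subset n) p k →
  (∣ U ∣ ≡ᵇ p ℕ.+ k) ∧ (∣ U ∩ X ∣ ≡ᵇ p) ≡ (∣ U ∩ X ∣ ≡ᵇ p) ∧ (∣ U ─ X ∣ ≡ᵇ k)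
split-size U X p k with ∣ U ∩ X ∣ ≡ᵇ p in eq
... | false = ∧-zeroʳ _
... | true with ≡ᵇ-true {∣ U ∩ X ∣} eq
...   | ≡.refl = ≡.trans (∧-identityʳ _) (≡.trans (≡.cong (_≡ᵇ ∣ U ∩ X ∣ ℕ.+ k) (≡.sym (∣p∩q∣+∣p─q∣≡∣p∣ U X))) (≡ᵇ-+ ∣ U ∩ X ∣ _ k))

-- Ring identities for cofactor expansions

module Identities {a ℓ} (R : CommutativeRing a ℓ) where
  private
    ACR : AlmostCommutativeRing a ℓ
    ACR = fromCommutativeRing R (λ _ → nothing)
  open AlmostCommutativeRing ACR hiding (-‿+-comm)
  open import Algebra.Properties.Ring (CommutativeRing.ring R)
  open import Relation.Binary.Reasoning.Setoid setoid

  cofactor-+ : ∀ x u v y z → x * (u + v) + - (y + z) ≈ x * u + - y + (x * v + - z)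
  cofactor-+ = solve-∀ ACR

  cofactor-* : ∀ x k u y → x * (k * u) + - (k * y) ≈ k * (x * u + - y)
  cofactor-* x k u y = begin
    x * (k * u) + - (k * y) ≈⟨ +-congˡ (-‿distribʳ-* k y) ⟩
    x * (k * u) + k * - y   ≈⟨ atoms x k u (- y) ⟩
    k * (x * u + - y)       ∎
    where
    atoms : ∀ x k u w → x * (k * u) + k * w ≈ k * (x * u + w)
    atoms = solve-∀ ACR

  cofactor-neg : ∀ x u y → x * - u + - - y ≈ - (x * u + - y)
  cofactor-neg x u y = begin
    x * - u + - - y     ≈⟨ +-congʳ (-‿distribʳ-* x u) ⟨
    - (x * u) + - - y   ≈⟨ -‿+-comm _ _ ⟩
    - (x * u + - y)     ∎

  cofactor-difference : ∀ x y u v w → (x + - y) * u + - (v + - w) ≈ x * u + - v + - (y * u + - w)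
  cofactor-difference x y u v w = begin
    (x + - y) * u + - (v + - w)            ≈⟨ +-cong (distribʳ u x (- y)) (sym (-‿+-comm v (- w))) ⟩
    x * u + - y * u + (- v + - - w)        ≈⟨ atoms _ _ _ _ ⟩
    x * u + - v + (- y * u + - - w)        ≈⟨ +-congˡ (+-congʳ (-‿distribˡ-* y u)) ⟨
    x * u + - v + (- (y * u) + - - w)      ≈⟨ +-congˡ (-‿+-comm _ _) ⟩
    x * u + - v + - (y * u + - w)          ∎
    where
    atoms : ∀ p q r s → p + q + (r + s) ≈ p + r + (q + s)
    atoms = solve-∀ ACR

  x-[y-z] : ∀ x y z → x + - (y + - z) ≈ x + - y + z
  x-[y-z] x y z = begin
    x + - (y + - z)    ≈⟨ +-congˡ (-‿+-comm y (- z)) ⟨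
    x + (- y + - - z)  ≈⟨ +-congˡ (+-congˡ (-‿involutive z)) ⟩
    x + (- y + z)      ≈⟨ +-assoc _ _ _ ⟨
    x + - y + z        ∎

  x-y-z : ∀ x y z → x + - y + - z ≈ - (y + - x + z)
  x-y-z x y z = begin
    x + - y + - z        ≈⟨ +-congʳ (+-comm _ _) ⟩
    - y + x + - z        ≈⟨ +-congʳ (+-congˡ (-‿involutive x)) ⟨
    - y + - - x + - z    ≈⟨ +-congʳ (-‿+-comm _ _) ⟩
    - (y + - x) + - z    ≈⟨ -‿+-comm _ _ ⟩
    - (y + - x + z)      ∎

  double-cofactor-neg : ∀ p q z → p + - (q + - - z) ≈ - (q + - (p + - z))
  double-cofactor-neg p q z = begin
    p + - (q + - - z)      ≈⟨ x-[y-z] p q (- z) ⟩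
    p + - q + - z          ≈⟨ x-y-z p q z ⟩
    - (q + - p + z)        ≈⟨ -‿cong (x-[y-z] q p z) ⟨
    - (q + - (p + - z))    ∎

-- Alternating forms on lists of arguments

module ExteriorForms {a ℓ} (R : CommutativeRing a ℓ) where
  open CommutativeRing R hiding (zero) renaming (Carrier to K)
  open Identities R
  open import Algebra.Properties.Ring ring
  open import Algebra.Properties.CommutativeSemigroup *-commutativeSemigroup using (x∙yz≈y∙xz)
  open import Algebra.Properties.CommutativeSemigroup +-commutativeSemigroup using () renaming (interchange to +-interchange)
  open import Relation.Binary.Reasoning.Setoid setoid

  sg : ℕ → K
  sg zero    = 1#
  sg (suc n) = - sg n

  sg-+ : ∀ m n → sg (m ℕ.+ n) ≈ sg m * sg n
  sg-+ zero    n = sym (*-identityˡ _)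
  sg-+ (suc m) n = trans (-‿cong (sg-+ m n)) (-‿distribˡ-* _ _)

  sg-square : ∀ n → sg n * sg n ≈ 1#
  sg-square zero    = *-identityˡ _
  sg-square (suc n) = begin
    - sg n * - sg n     ≈⟨ -‿distribˡ-* _ _ ⟨
    - (sg n * - sg n)   ≈⟨ -‿cong (-‿distribʳ-* _ _) ⟨
    - - (sg n * sg n)   ≈⟨ -‿involutive _ ⟩
    sg n * sg n         ≈⟨ sg-square n ⟩
    1#                  ∎

  sg-cancel : ∀ n x → sg n * (sg n * x) ≈ x
  sg-cancel n x = begin
    sg n * (sg n * x) ≈⟨ *-assoc _ _ _ ⟨
    sg n * sg n * x   ≈⟨ *-congʳ (sg-square n) ⟩
    1# * x            ≈⟨ *-identityˡ x ⟩
    x                 ∎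

  module _ {c} {C : Set c} where

    infix 4 _≐_
    infixr 5 _▷_

    _≐_ : (List C → K) → (List C → K) → Set _
    f ≐ g = ∀ l → f l ≈ g l

    -- The exterior product of a one-form with a form, where a form is a function of the list of
    -- its arguments; this is cofactor expansion along the row φ.
    _▷_ : (C → K) → (List C → K) → List C → K
    (φ ▷ f) []       = 0#
    (φ ▷ f) (c ∷ cs) = φ c * f cs + - (φ ▷ f ∘ (c ∷_)) cs

    ▷-cong : ∀ {φ ψ f g} → (∀ c → φ c ≈ ψ c) → f ≐ g → φ ▷ f ≐ ψ ▷ g
    ▷-cong p q []       = refl
    ▷-cong p q (c ∷ cs) = +-cong (*-cong (p c) (q cs)) (-‿cong (▷-cong p (q ∘ (c ∷_)) cs))

    ▷-congʳ : ∀ {φ f g} → f ≐ g → φ ▷ f ≐ φ ▷ g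
    ▷-congʳ = ▷-cong (λ _ → refl)

    ▷-+ : ∀ φ f g cs → (φ ▷ λ l → f l + g l) cs ≈ (φ ▷ f) cs + (φ ▷ g) cs
    ▷-+ φ f g []       = sym (+-identityˡ _)
    ▷-+ φ f g (c ∷ cs) = trans (+-congˡ (-‿cong (▷-+ φ (f ∘ (c ∷_)) (g ∘ (c ∷_)) cs))) (cofactor-+ _ _ _ _ _)

    ▷-* : ∀ φ k f cs → (φ ▷ λ l → k * f l) cs ≈ k * (φ ▷ f) cs
    ▷-* φ k f []       = sym (zeroʳ k)
    ▷-* φ k f (c ∷ cs) = trans (+-congˡ (-‿cong (▷-* φ k (f ∘ (c ∷_)) cs))) (cofactor-* _ _ _ _)

    ▷-neg : ∀ φ f cs → (φ ▷ λ l → - f l) cs ≈ - (φ ▷ f) cs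
    ▷-neg φ f []       = sym -0#≈0#
    ▷-neg φ f (c ∷ cs) = trans (+-congˡ (-‿cong (▷-neg φ (f ∘ (c ∷_)) cs))) (cofactor-neg _ _ _)

    ▷-zero : ∀ {φ f} → (∀ l → f l ≈ 0#) → ∀ cs → (φ ▷ f) cs ≈ 0#
    ▷-zero z []       = refl
    ▷-zero z (c ∷ cs) = begin
      _ * _ + - _      ≈⟨ +-cong (*-congˡ (z cs)) (-‿cong (▷-zero (z ∘ (c ∷_)) cs)) ⟩
      _ * 0# + - 0#    ≈⟨ +-cong (zeroʳ _) -0#≈0# ⟩
      0# + 0#          ≈⟨ +-identityˡ _ ⟩
      0#               ∎

    ▷-difference : ∀ φ ψ f cs → ((λ c → φ c + - ψ c) ▷ f) cs ≈ (φ ▷ f) cs + - (ψ ▷ f) cs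
    ▷-difference φ ψ f []       = sym (-‿inverseʳ 0#)
    ▷-difference φ ψ f (c ∷ cs) = trans (+-congˡ (-‿cong (▷-difference φ ψ (f ∘ (c ∷_)) cs))) (cofactor-difference _ _ _ _ _)

    -- The first argument goes to `φ`, to `ψ` or to `f`; in the last case it passes two rows and the
    -- signs cancel. The first two terms together are antisymmetric in `φ` and `ψ`, which yields
    -- `▷-anticomm` and `▷-square` by induction.
    ▷-▷-∷ : ∀ φ ψ f c cs →
      (φ ▷ ψ ▷ f) (c ∷ cs) ≈ φ c * (ψ ▷ f) cs + - (ψ c * (φ ▷ f) cs) + (φ ▷ ψ ▷ f ∘ (c ∷_)) cs
    ▷-▷-∷ φ ψ f c cs = begin
      φ c * (ψ ▷ f) cs + - (φ ▷ λ l → ψ c * f l + - (ψ ▷ f ∘ (c ∷_)) l) cs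
        ≈⟨ +-congˡ (-‿cong (trans (▷-+ φ _ _ cs) (+-cong (▷-* φ _ f cs) (▷-neg φ _ cs)))) ⟩
      φ c * (ψ ▷ f) cs + - (ψ c * (φ ▷ f) cs + - (φ ▷ ψ ▷ f ∘ (c ∷_)) cs)
        ≈⟨ x-[y-z] _ _ _ ⟩
      _ ∎

    ▷-anticomm : ∀ φ ψ f cs → (φ ▷ ψ ▷ f) cs ≈ - (ψ ▷ φ ▷ f) cs
    ▷-anticomm φ ψ f []       = sym -0#≈0#
    ▷-anticomm φ ψ f (c ∷ cs) = begin
      (φ ▷ ψ ▷ f) (c ∷ cs)  ≈⟨ ▷-▷-∷ φ ψ f c cs ⟩
      _                     ≈⟨ +-congˡ (▷-anticomm φ ψ (f ∘ (c ∷_)) cs) ⟩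
      _                     ≈⟨ x-y-z _ _ _ ⟩
      - _                   ≈⟨ -‿cong (▷-▷-∷ ψ φ f c cs) ⟨
      - (ψ ▷ φ ▷ f) (c ∷ cs) ∎

    ▷-square : ∀ φ f cs → (φ ▷ φ ▷ f) cs ≈ 0#
    ▷-square φ f []       = refl
    ▷-square φ f (c ∷ cs) = begin
      (φ ▷ φ ▷ f) (c ∷ cs)  ≈⟨ ▷-▷-∷ φ φ f c cs ⟩
      _                     ≈⟨ +-cong (-‿inverseʳ _) (▷-square φ (f ∘ (c ∷_)) cs) ⟩
      0# + 0#               ≈⟨ +-identityˡ _ ⟩
      0#                    ∎

    record Skew (f : List C → K) : Set (c ⊔ ℓ) where
      constructor skew
      field swap : ∀ pre x y post → f (pre ++ x ∷ y ∷ post) ≈ - f (pre ++ y ∷ x ∷ post)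
    open Skew public

    -- Kept apart from `Skew`, since in characteristic 2 antisymmetry does not imply vanishing on a
    -- repeated argument.
    record Repeat (f : List C → K) : Set (c ⊔ ℓ) where
      constructor repeat
      field vanish : ∀ pre x post → f (pre ++ x ∷ x ∷ post) ≈ 0#
    open Repeat public

    -- Argument lists carry no length, so homogeneity is expressed as vanishing off one length. It
    -- makes the sign in `involute` constant and fixes the size of the sets in Laplace expansions.
    record Degree (r : ℕ) (f : List C → K) : Set (c ⊔ ℓ) where
      constructor degree
      field off-degree : ∀ l → length l ≢ r → f l ≈ 0#
    open Degree public

    Skew-∷ : ∀ {f} → Skew f → ∀ x → Skew (f ∘ (x ∷_))
    Skew-∷ s x = skew λ pre → swap s (x ∷ pre)

    Repeat-∷ : ∀ {f} → Repeat f → ∀ x → Repeat (f ∘ (x ∷_))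
    Repeat-∷ s x = repeat λ pre → vanish s (x ∷ pre)

    -- When the transposed pair stands in front, its two cofactors trade places with opposite signs,
    -- and the remaining terms still contain the pair inside `f`.
    ▷-skew : ∀ φ {f} → Skew f → Skew (φ ▷ f)
    ▷-skew φ s = skew (go s)
      where
      go : ∀ {f} → Skew f → ∀ pre x y post → (φ ▷ f) (pre ++ x ∷ y ∷ post) ≈ - (φ ▷ f) (pre ++ y ∷ x ∷ post)
      go {f} s []        x y post = begin
        φ x * f (y ∷ post) + - (φ y * f (x ∷ post) + - (φ ▷ λ l → f (x ∷ y ∷ l)) post)
          ≈⟨ +-congˡ (-‿cong (+-congˡ (-‿cong (trans (▷-congʳ (swap s [] x y) post) (▷-neg φ _ post))))) ⟩
        φ x * f (y ∷ post) + - (φ y * f (x ∷ post) + - - (φ ▷ λ l → f (y ∷ x ∷ l)) post)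
          ≈⟨ double-cofactor-neg _ _ _ ⟩
        - (φ y * f (x ∷ post) + - (φ x * f (y ∷ post) + - (φ ▷ λ l → f (y ∷ x ∷ l)) post)) ∎
      go {f} s (p ∷ pre) x y post = begin
        φ p * f (pre ++ x ∷ y ∷ post) + - (φ ▷ f ∘ (p ∷_)) (pre ++ x ∷ y ∷ post)
          ≈⟨ +-cong (*-congˡ (swap s pre x y post)) (-‿cong (go (Skew-∷ s p) pre x y post)) ⟩
        φ p * - f (pre ++ y ∷ x ∷ post) + - - (φ ▷ f ∘ (p ∷_)) (pre ++ y ∷ x ∷ post)
          ≈⟨ cofactor-neg _ _ _ ⟩
        - (φ p * f (pre ++ y ∷ x ∷ post) + - (φ ▷ f ∘ (p ∷_)) (pre ++ y ∷ x ∷ post)) ∎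

    ▷-repeat : ∀ φ {f} → Repeat f → Repeat (φ ▷ f)
    ▷-repeat φ s = repeat (go s)
      where
      go : ∀ {f} → Repeat f → ∀ pre x post → (φ ▷ f) (pre ++ x ∷ x ∷ post) ≈ 0#
      go {f} s []        x post = begin
        φ x * f (x ∷ post) + - (φ x * f (x ∷ post) + - (φ ▷ λ l → f (x ∷ x ∷ l)) post)
          ≈⟨ +-congˡ (-‿cong (trans (+-congˡ (trans (-‿cong (▷-zero (vanish s [] x) post)) -0#≈0#)) (+-identityʳ _))) ⟩
        φ x * f (x ∷ post) + - (φ x * f (x ∷ post))
          ≈⟨ -‿inverseʳ _ ⟩
        0# ∎
      go {f} s (p ∷ pre) x post = begin
        φ p * f (pre ++ x ∷ x ∷ post) + - (φ ▷ f ∘ (p ∷_)) (pre ++ x ∷ x ∷ post)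
          ≈⟨ +-cong (*-congˡ (vanish s pre x post)) (-‿cong (go (Repeat-∷ s p) pre x post)) ⟩
        φ p * 0# + - 0#  ≈⟨ +-cong (zeroʳ _) -0#≈0# ⟩
        0# + 0#          ≈⟨ +-identityˡ _ ⟩
        0# ∎

    Degree-∷ : ∀ {r f} → Degree (suc r) f → ∀ x → Degree r (f ∘ (x ∷_))
    Degree-∷ d x = degree λ l ne → off-degree d (x ∷ l) (ne ∘ ℕ.suc-injective)

    Degree-++ : ∀ {r f} xs → Degree (length xs ℕ.+ r) f → Degree r (f ∘ (xs ++_))
    Degree-++ []       d = d
    Degree-++ (x ∷ xs) d = Degree-++ xs (Degree-∷ d x)

    ▷-degree : ∀ φ {r f} → Degree r f → Degree (suc r) (φ ▷ f)
    ▷-degree φ d = degree (go d)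
      where
      go : ∀ {r f} → Degree r f → ∀ l → length l ≢ suc r → (φ ▷ f) l ≈ 0#
      go d [] ne = refl
      go {r} {f} d (c ∷ cs) ne = begin
        φ c * f cs + - (φ ▷ f ∘ (c ∷_)) cs
          ≈⟨ +-cong (trans (*-congˡ (off-degree d cs (ne ∘ ≡.cong suc))) (zeroʳ _))
                    (trans (-‿cong (rest r d (ne ∘ ≡.cong suc))) -0#≈0#) ⟩
        0# + 0#  ≈⟨ +-identityˡ _ ⟩
        0# ∎
        where
        rest : ∀ r → Degree r f → length cs ≢ r → (φ ▷ f ∘ (c ∷_)) cs ≈ 0#
        -- The recursion would need degree -1 here; instead, a form of degree 0 vanishes as soon as
        -- it has received `c`.
        rest zero    d _  = ▷-zero (λ l → off-degree d (c ∷ l) λ ()) cs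
        rest (suc r) d ne = go (Degree-∷ d c) cs ne

    Skew-move : ∀ {f} → Skew f → ∀ x ys post → f (x ∷ ys ++ post) ≈ sg (length ys) * f (ys ++ x ∷ post)
    Skew-move {f} s x []       post = sym (*-identityˡ _)
    Skew-move {f} s x (y ∷ ys) post = begin
      f (x ∷ y ∷ ys ++ post)                      ≈⟨ swap s [] x y _ ⟩
      - f (y ∷ x ∷ ys ++ post)                    ≈⟨ -‿cong (Skew-move (Skew-∷ s y) x ys post) ⟩
      - (sg (length ys) * f (y ∷ ys ++ x ∷ post)) ≈⟨ -‿distribˡ-* _ _ ⟩
      _ ∎

    Skew-move⁻ : ∀ {f} → Skew f → ∀ x ys post → f (ys ++ x ∷ post) ≈ sg (length ys) * f (x ∷ ys ++ post)
    Skew-move⁻ {f} s x ys post = begin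
      f (ys ++ x ∷ post)                                     ≈⟨ sg-cancel (length ys) _ ⟨
      sg (length ys) * (sg (length ys) * f (ys ++ x ∷ post)) ≈⟨ *-congˡ (Skew-move s x ys post) ⟨
      sg (length ys) * f (x ∷ ys ++ post)                    ∎

    Skew-block : ∀ {f} → Skew f → ∀ xs ys post →
      f (xs ++ ys ++ post) ≈ sg (length xs ℕ.* length ys) * f (ys ++ xs ++ post)
    Skew-block {f} s []       ys post = sym (*-identityˡ _)
    Skew-block {f} s (x ∷ xs) ys post = begin
      f (x ∷ xs ++ ys ++ post)
        ≈⟨ Skew-block (Skew-∷ s x) xs ys post ⟩
      sg (length xs ℕ.* length ys) * f (x ∷ ys ++ xs ++ post)
        ≈⟨ *-congˡ (Skew-move s x ys _) ⟩
      sg (length xs ℕ.* length ys) * (sg (length ys) * f (ys ++ x ∷ xs ++ post))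
        ≈⟨ trans (sym (*-assoc _ _ _)) (*-congʳ (*-comm _ _)) ⟩
      sg (length ys) * sg (length xs ℕ.* length ys) * f (ys ++ x ∷ xs ++ post)
        ≈⟨ *-congʳ (sg-+ (length ys) _) ⟨
      _ ∎

    repeated-zero : ∀ {f} → Skew f → Repeat f → ∀ pre x mid post → f (pre ++ x ∷ mid ++ x ∷ post) ≈ 0#
    repeated-zero s z (p ∷ pre) x mid post = repeated-zero (Skew-∷ s p) (Repeat-∷ z p) pre x mid post
    repeated-zero {f} s z [] x mid post = begin
      f (x ∷ mid ++ x ∷ post)     ≈⟨ Skew-move s x mid _ ⟩
      _ * f (mid ++ x ∷ x ∷ post) ≈⟨ *-congˡ (vanish z mid x post) ⟩
      _ * 0#                      ≈⟨ zeroʳ _ ⟩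
      0# ∎

  -- Homogeneity in a single argument

  module _ {c} {C : Set c} where

    -- `S x y` stands for "x is k times y". The factor 1 gives congruence for pointwise equal
    -- columns, -1 extracts signs, and 0 gives vanishing at the zero column.
    record Scaling {s} (S : C → C → Set s) (k : K) (f : List C → K) : Set (c ⊔ ℓ ⊔ s) where
      constructor scaling
      field scale : ∀ pre {x y} post → S x y → f (pre ++ x ∷ post) ≈ k * f (pre ++ y ∷ post)
    open Scaling public

    Scaling-∷ : ∀ {s} {S : C → C → Set s} {k f} → Scaling S k f → ∀ x → Scaling S k (f ∘ (x ∷_))
    Scaling-∷ s x = scaling λ pre → scale s (x ∷ pre)

    ▷-scaling : ∀ {s} {S : C → C → Set s} {k φ f} → (∀ {x y} → S x y → φ x ≈ k * φ y) →
      Scaling S k f → Scaling S k (φ ▷ f)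
    ▷-scaling {S = S} {k} {φ} p s = scaling (go s)
      where
      go : ∀ {f} → Scaling S k f → ∀ pre {x y} post → S x y → (φ ▷ f) (pre ++ x ∷ post) ≈ k * (φ ▷ f) (pre ++ y ∷ post)
      go {f} s [] {x} {y} post r = begin
        φ x * f post + - (φ ▷ f ∘ (x ∷_)) post
          ≈⟨ +-cong (trans (*-congʳ (p r)) (*-assoc _ _ _))
                    (trans (-‿cong (trans (▷-congʳ (λ l → scale s [] l r) post) (▷-* φ k _ post))) (-‿distribʳ-* _ _)) ⟩
        k * (φ y * f post) + k * - (φ ▷ f ∘ (y ∷_)) post
          ≈⟨ distribˡ k _ _ ⟨
        k * (φ y * f post + - (φ ▷ f ∘ (y ∷_)) post) ∎
      go {f} s (q ∷ pre) {x} {y} post r = begin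
        φ q * f (pre ++ x ∷ post) + - (φ ▷ f ∘ (q ∷_)) (pre ++ x ∷ post)
          ≈⟨ +-cong (*-congˡ (scale s pre post r)) (-‿cong (go (Scaling-∷ s q) pre post r)) ⟩
        φ q * (k * f (pre ++ y ∷ post)) + - (k * (φ ▷ f ∘ (q ∷_)) (pre ++ y ∷ post))
          ≈⟨ cofactor-* _ _ _ _ ⟩
        k * (φ q * f (pre ++ y ∷ post) + - (φ ▷ f ∘ (q ∷_)) (pre ++ y ∷ post)) ∎

    scale-one : ∀ {s} {S : C → C → Set s} {f} → Scaling S 1# f → ∀ {xs ys} post → Pointwise S xs ys →
      f (xs ++ post) ≈ f (ys ++ post)
    scale-one s post []       = refl
    scale-one s post (_∷_ {y = y} {xs = xs} p ps) =
      trans (scale s [] (xs ++ post) p) (trans (*-identityˡ _) (scale-one (Scaling-∷ s y) post ps))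

    scale-neg : ∀ {s} {S : C → C → Set s} {f} → Scaling S (- 1#) f → ∀ {xs ys} post → Pointwise S xs ys →
      f (xs ++ post) ≈ sg (length ys) * f (ys ++ post)
    scale-neg s post []       = sym (*-identityˡ _)
    scale-neg {f = f} s post (_∷_ {y = y} {xs = xs} {ys = ys} p ps) = begin
      _                                        ≈⟨ scale s [] (xs ++ post) p ⟩
      - 1# * f (y ∷ xs ++ post)                ≈⟨ -1*x≈-x _ ⟩
      - f (y ∷ xs ++ post)                     ≈⟨ -‿cong (scale-neg (Scaling-∷ s y) post ps) ⟩
      - (sg (length ys) * f (y ∷ ys ++ post))  ≈⟨ -‿distribˡ-* _ _ ⟩
      - sg (length ys) * f (y ∷ ys ++ post)    ∎

  module _ {c d} {C : Set c} {D : Set d} (h : C → D) where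

    ▷-map : ∀ φ f cs → (φ ▷ f) (map h cs) ≈ ((φ ∘ h) ▷ (f ∘ map h)) cs
    ▷-map φ f []       = refl
    ▷-map φ f (c ∷ cs) = +-congˡ (-‿cong (▷-map φ (f ∘ (h c ∷_)) cs))

    Skew-map : ∀ {f} → Skew f → Skew (f ∘ map h)
    Skew-map {f} s = skew λ pre x y post →
      ≡.subst₂ (λ u v → f u ≈ - f v) (≡.sym (map-++ h pre _)) (≡.sym (map-++ h pre _)) (swap s (map h pre) (h x) (h y) (map h post))

    Repeat-map : ∀ {f} → Repeat f → Repeat (f ∘ map h)
    Repeat-map {f} s = repeat λ pre x post →
      ≡.subst (λ u → f u ≈ 0#) (≡.sym (map-++ h pre _)) (vanish s (map h pre) (h x) (map h post))

    Degree-map : ∀ {r f} → Degree r f → Degree r (f ∘ map h)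
    Degree-map d = degree λ l ne → off-degree d (map h l) (ne ∘ ≡.trans (≡.sym (length-map h l)))

    Scaling-map : ∀ {s s′} {S : C → C → Set s} {S′ : D → D → Set s′} {k f} → (∀ {x y} → S x y → S′ (h x) (h y)) →
      Scaling S′ k f → Scaling S k (f ∘ map h)
    Scaling-map {k = k} {f} p s = scaling λ pre {x} {y} post r →
      ≡.subst₂ (λ u v → f u ≈ k * f v) (≡.sym (map-++ h pre _)) (≡.sym (map-++ h pre _)) (scale s (map h pre) (map h post) (p r))

  -- Exterior product of two forms

  module _ {c} {C : Set c} where

    -- The grade involution: the sign for moving one further argument or row past all arguments of
    -- `f`.
    involute : (List C → K) → List C → K
    involute f l = sg (length l) * f l

    -- The exterior product of f and g as a form on pairs: expanding along the arguments, each pair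
    -- passes either its first component to f or its second component to g.
    _⊛_ : (List C → K) → (List C → K) → List (C × C) → K
    (f ⊛ g) []             = f [] * g []
    (f ⊛ g) ((t , b) ∷ cs) = ((f ∘ (t ∷_)) ⊛ g) cs + (involute f ⊛ (g ∘ (b ∷_))) cs

    involute-cong : ∀ {f f′} → f ≐ f′ → involute f ≐ involute f′
    involute-cong p l = *-congˡ (p l)

    ⊛-cong : ∀ {f f′ g g′} → f ≐ f′ → g ≐ g′ → ∀ cs → (f ⊛ g) cs ≈ (f′ ⊛ g′) cs
    ⊛-cong p q []             = *-cong (p []) (q [])
    ⊛-cong p q ((t , b) ∷ cs) = +-cong (⊛-cong (p ∘ (t ∷_)) q cs) (⊛-cong (involute-cong p) (q ∘ (b ∷_)) cs)

    ⊛-+ˡ : ∀ f f′ g cs → ((λ l → f l + f′ l) ⊛ g) cs ≈ (f ⊛ g) cs + (f′ ⊛ g) cs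
    ⊛-+ˡ f f′ g []             = distribʳ _ _ _
    ⊛-+ˡ f f′ g ((t , b) ∷ cs) = begin
      _ ≈⟨ +-cong (⊛-+ˡ _ _ _ cs) (trans (⊛-cong (λ _ → distribˡ _ _ _) (λ _ → refl) cs) (⊛-+ˡ _ _ _ cs)) ⟩
      _ ≈⟨ +-interchange _ _ _ _ ⟩
      _ ∎

    ⊛-+ʳ : ∀ f g g′ cs → (f ⊛ (λ l → g l + g′ l)) cs ≈ (f ⊛ g) cs + (f ⊛ g′) cs
    ⊛-+ʳ f g g′ []             = distribˡ _ _ _
    ⊛-+ʳ f g g′ ((t , b) ∷ cs) = begin
      _ ≈⟨ +-cong (⊛-+ʳ _ _ _ cs) (⊛-+ʳ _ _ _ cs) ⟩
      _ ≈⟨ +-interchange _ _ _ _ ⟩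
      _ ∎

    ⊛-*ˡ : ∀ k f g cs → ((λ l → k * f l) ⊛ g) cs ≈ k * (f ⊛ g) cs
    ⊛-*ˡ k f g []             = *-assoc _ _ _
    ⊛-*ˡ k f g ((t , b) ∷ cs) = begin
      _ ≈⟨ +-cong (⊛-*ˡ _ _ _ cs) (trans (⊛-cong (λ _ → x∙yz≈y∙xz _ _ _) (λ _ → refl) cs) (⊛-*ˡ _ _ _ cs)) ⟩
      _ ≈⟨ distribˡ _ _ _ ⟨
      _ ∎

    ⊛-*ʳ : ∀ k f g cs → (f ⊛ (λ l → k * g l)) cs ≈ k * (f ⊛ g) cs
    ⊛-*ʳ k f g []             = x∙yz≈y∙xz _ _ _
    ⊛-*ʳ k f g ((t , b) ∷ cs) = begin
      _ ≈⟨ +-cong (⊛-*ʳ _ _ _ cs) (⊛-*ʳ _ _ _ cs) ⟩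
      _ ≈⟨ distribˡ _ _ _ ⟨
      _ ∎

    ⊛-negˡ : ∀ f g cs → ((λ l → - f l) ⊛ g) cs ≈ - (f ⊛ g) cs
    ⊛-negˡ f g cs = begin
      _                   ≈⟨ ⊛-cong (λ _ → sym (-1*x≈-x _)) (λ _ → refl) cs ⟩
      _                   ≈⟨ ⊛-*ˡ (- 1#) f g cs ⟩
      - 1# * (f ⊛ g) cs   ≈⟨ -1*x≈-x _ ⟩
      - (f ⊛ g) cs        ∎

    ⊛-negʳ : ∀ f g cs → (f ⊛ (λ l → - g l)) cs ≈ - (f ⊛ g) cs
    ⊛-negʳ f g cs = begin
      _                   ≈⟨ ⊛-cong (λ _ → refl) (λ _ → sym (-1*x≈-x _)) cs ⟩
      _                   ≈⟨ ⊛-*ʳ (- 1#) f g cs ⟩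
      - 1# * (f ⊛ g) cs   ≈⟨ -1*x≈-x _ ⟩
      - (f ⊛ g) cs        ∎

    ⊛-zeroˡ : ∀ {f g} → (∀ l → f l ≈ 0#) → ∀ cs → (f ⊛ g) cs ≈ 0#
    ⊛-zeroˡ {f} {g} z cs = begin
      (f ⊛ g) cs                   ≈⟨ ⊛-cong (λ l → trans (z l) (sym (zeroˡ (f l)))) (λ _ → refl) cs ⟩
      ((λ l → 0# * f l) ⊛ g) cs    ≈⟨ ⊛-*ˡ 0# f g cs ⟩
      0# * (f ⊛ g) cs              ≈⟨ zeroˡ _ ⟩
      0#                           ∎

    ⊛-zeroʳ : ∀ {f g} → (∀ l → g l ≈ 0#) → ∀ cs → (f ⊛ g) cs ≈ 0#
    ⊛-zeroʳ {f} {g} z cs = begin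
      (f ⊛ g) cs                   ≈⟨ ⊛-cong (λ _ → refl) (λ l → trans (z l) (sym (zeroˡ (g l)))) cs ⟩
      (f ⊛ (λ l → 0# * g l)) cs    ≈⟨ ⊛-*ʳ 0# f g cs ⟩
      0# * (f ⊛ g) cs              ≈⟨ zeroˡ _ ⟩
      0#                           ∎

    involute-▷ : ∀ φ f l → involute (φ ▷ f) l ≈ - (φ ▷ involute f) l
    involute-▷ φ f []       = trans (zeroʳ _) (sym -0#≈0#)
    involute-▷ φ f (c ∷ cs) = begin
      - s * (φ c * f cs + - (φ ▷ f ∘ (c ∷_)) cs)
        ≈⟨ -‿distribˡ-* _ _ ⟨
      - (s * (φ c * f cs + - (φ ▷ f ∘ (c ∷_)) cs))
        ≈⟨ -‿cong (cofactor-* (φ c) s (f cs) _) ⟨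
      - (φ c * (s * f cs) + - (s * (φ ▷ f ∘ (c ∷_)) cs))
        ≈⟨ -‿cong (+-congˡ (-‿cong (involute-▷ φ (f ∘ (c ∷_)) cs))) ⟩
      - (φ c * (s * f cs) + - - (φ ▷ involute (f ∘ (c ∷_))) cs)
        ≈⟨ -‿cong (+-congˡ (-‿cong (trans (▷-congʳ (λ _ → sym (-‿distribˡ-* _ _)) cs) (▷-neg φ _ cs)))) ⟨
      - (φ c * (s * f cs) + - (φ ▷ involute f ∘ (c ∷_)) cs) ∎
      where s = sg (length cs)

    -- Associativity of the exterior product; a row of the first factor reads the first components
    -- of the pairs.
    ▷-⊛ : ∀ φ f g cs → ((φ ▷ f) ⊛ g) cs ≈ ((φ ∘ proj₁) ▷ (f ⊛ g)) cs
    ▷-⊛ φ f g []             = zeroˡ _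
    ▷-⊛ φ f g ((t , b) ∷ cs) = begin
      ((λ l → φ t * f l + - (φ ▷ f ∘ (t ∷_)) l) ⊛ g) cs + (involute (φ ▷ f) ⊛ (g ∘ (b ∷_))) cs
        ≈⟨ +-cong
             (trans (⊛-+ˡ _ _ g cs) (+-cong (⊛-*ˡ _ f g cs) (⊛-negˡ _ g cs)))
             (trans (⊛-cong (involute-▷ φ f) (λ _ → refl) cs) (⊛-negˡ _ _ cs)) ⟩
      φ t * (f ⊛ g) cs + - ((φ ▷ f ∘ (t ∷_)) ⊛ g) cs + - ((φ ▷ involute f) ⊛ (g ∘ (b ∷_))) cs
        ≈⟨ +-cong (+-congˡ (-‿cong (▷-⊛ φ _ g cs))) (-‿cong (▷-⊛ φ _ _ cs)) ⟩
      φ t * (f ⊛ g) cs + - ((φ ∘ proj₁) ▷ ((f ∘ (t ∷_)) ⊛ g)) cs + - ((φ ∘ proj₁) ▷ (involute f ⊛ (g ∘ (b ∷_)))) cs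
        ≈⟨ trans (+-assoc _ _ _) (+-congˡ (-‿+-comm _ _)) ⟩
      φ t * (f ⊛ g) cs + - (((φ ∘ proj₁) ▷ ((f ∘ (t ∷_)) ⊛ g)) cs + ((φ ∘ proj₁) ▷ (involute f ⊛ (g ∘ (b ∷_)))) cs)
        ≈⟨ +-congˡ (-‿cong (▷-+ _ _ _ cs)) ⟨
      ((φ ∘ proj₁) ▷ (f ⊛ g)) ((t , b) ∷ cs) ∎

    -- To come to the front, a row of the second factor has to pass all of `f`, and `involute f`
    -- records the sign.
    ⊛-▷ : ∀ φ f g cs → (f ⊛ (φ ▷ g)) cs ≈ ((φ ∘ proj₂) ▷ (involute f ⊛ g)) cs
    ⊛-▷ φ f g []             = zeroʳ _
    ⊛-▷ φ f g ((t , b) ∷ cs) = begin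
      ((f ∘ (t ∷_)) ⊛ (φ ▷ g)) cs + (involute f ⊛ (λ l → φ b * g l + - (φ ▷ g ∘ (b ∷_)) l)) cs
        ≈⟨ +-cong (⊛-▷ φ _ g cs) (trans (⊛-+ʳ _ _ _ cs) (+-cong (⊛-*ʳ _ _ g cs) (⊛-negʳ _ _ cs))) ⟩
      (ψ ▷ (involute (f ∘ (t ∷_)) ⊛ g)) cs + (φ b * (involute f ⊛ g) cs + - (involute f ⊛ (φ ▷ g ∘ (b ∷_))) cs)
        ≈⟨ +-congˡ (+-congˡ (-‿cong (⊛-▷ φ _ _ cs))) ⟩
      (ψ ▷ (involute (f ∘ (t ∷_)) ⊛ g)) cs + (φ b * (involute f ⊛ g) cs + - (ψ ▷ (involute (involute f) ⊛ (g ∘ (b ∷_)))) cs)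
        ≈⟨ trans (+-comm _ _) (trans (+-assoc _ _ _) (+-congˡ (+-comm _ _))) ⟩
      φ b * (involute f ⊛ g) cs + ((ψ ▷ (involute (f ∘ (t ∷_)) ⊛ g)) cs + - (ψ ▷ (involute (involute f) ⊛ (g ∘ (b ∷_)))) cs)
        ≈⟨ +-congˡ (trans (+-congʳ (sym (-‿involutive _))) (-‿+-comm _ _)) ⟩
      φ b * (involute f ⊛ g) cs + - (- (ψ ▷ (involute (f ∘ (t ∷_)) ⊛ g)) cs + (ψ ▷ (involute (involute f) ⊛ (g ∘ (b ∷_)))) cs)
        ≈⟨ +-congˡ (-‿cong (+-congʳ (trans (sym (▷-neg ψ _ cs)) (▷-congʳ (λ l → sym (involute-∷ l)) cs)))) ⟩
      φ b * (involute f ⊛ g) cs + - ((ψ ▷ ((involute f ∘ (t ∷_)) ⊛ g)) cs + (ψ ▷ (involute (involute f) ⊛ (g ∘ (b ∷_)))) cs)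
        ≈⟨ +-congˡ (-‿cong (▷-+ _ _ _ cs)) ⟨
      (ψ ▷ (involute f ⊛ g)) ((t , b) ∷ cs) ∎
      where
      ψ = φ ∘ proj₂
      involute-∷ : ∀ l → ((involute f ∘ (t ∷_)) ⊛ g) l ≈ - (involute (f ∘ (t ∷_)) ⊛ g) l
      involute-∷ l = trans (⊛-cong (λ _ → sym (-‿distribˡ-* _ _)) (λ _ → refl) l) (⊛-negˡ _ g l)

    involute-degree : ∀ {r f} → Degree r f → ∀ l → involute f l ≈ sg r * f l
    involute-degree {r} {f} d l with length l ℕ.≟ r
    ... | yes eq = *-congʳ (reflexive (≡.cong sg eq))
    ... | no  ne = trans (*-congˡ z) (trans (zeroʳ _) (sym (trans (*-congˡ z) (zeroʳ _))))
      where z = off-degree d l ne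

  pair-map : ∀ {c d} {C : Set c} {D : Set d} → (C → D) → C × C → D × D
  pair-map h (t , b) = h t , h b

  ⊛-map : ∀ {c d} {C : Set c} {D : Set d} (h : C → D) f g cs →
    ((f ∘ map h) ⊛ (g ∘ map h)) cs ≈ (f ⊛ g) (map (pair-map h) cs)
  ⊛-map h f g []             = refl
  ⊛-map h f g ((t , b) ∷ cs) = +-cong (⊛-map h _ g cs)
    (trans (⊛-cong (λ l → *-congʳ (reflexive (≡.cong sg (≡.sym (length-map h l))))) (λ _ → refl) cs) (⊛-map h _ _ cs))

  -- Determinants and the invariance under the shear

  Column : ℕ → Set a
  Column r = Fin r → K

  top : ∀ {r} → Column (suc r) → K
  top v = v zero

  below : ∀ {r} → Column (suc r) → Column r
  below v i = v (suc i)

  -- The determinant as the iterated exterior product of its rows; it inherits its properties from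
  -- their preservation under `▷`.
  Δ : ∀ r → List (Column r) → K
  Δ zero    []      = 1#
  Δ zero    (_ ∷ _) = 0#
  Δ (suc r) = top ▷ (Δ r ∘ map below)

  infix 4 _≋_·_
  _≋_·_ : ∀ {r} → Column r → K → Column r → Set ℓ
  v ≋ k · w = ∀ i → v i ≈ k * w i

  Δ-skew : ∀ r → Skew (Δ r)
  Δ-skew zero    = skew λ { [] _ _ _ → sym -0#≈0# ; (_ ∷ _) _ _ _ → sym -0#≈0# }
  Δ-skew (suc r) = ▷-skew top (Skew-map below (Δ-skew r))

  Δ-repeat : ∀ r → Repeat (Δ r)
  Δ-repeat zero    = repeat λ { [] _ _ → refl ; (_ ∷ _) _ _ → refl }
  Δ-repeat (suc r) = ▷-repeat top (Repeat-map below (Δ-repeat r))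

  Δ-degree : ∀ r → Degree r (Δ r)
  Δ-degree zero    = degree λ { [] ne → contradiction ≡.refl ne ; (_ ∷ _) _ → refl }
  Δ-degree (suc r) = ▷-degree top (Degree-map below (Δ-degree r))

  Δ-scaling : ∀ r k → Scaling (_≋ k ·_) k (Δ r)
  Δ-scaling zero    k = scaling λ { [] _ _ → sym (zeroʳ k) ; (_ ∷ _) _ _ → sym (zeroʳ k) }
  Δ-scaling (suc r) k = ▷-scaling (λ p → p zero) (Scaling-map below (λ p → p ∘ suc) (Δ-scaling r k))

  -- The determinant of the 2r × 2r matrix obtained from the r × N matrices T (first components) and
  -- B (second components) by listing the rows in the order T₁, B₁, T₂, B₂, ….
  Δ² : ∀ r → List (Column r × Column r) → K
  Δ² zero    []      = 1#
  Δ² zero    (_ ∷ _) = 0#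
  Δ² (suc r) = (top ∘ proj₁) ▷ (top ∘ proj₂) ▷ (Δ² r ∘ map (pair-map below))

  Δ²-skew : ∀ r → Skew (Δ² r)
  Δ²-skew zero    = skew λ { [] _ _ _ → sym -0#≈0# ; (_ ∷ _) _ _ _ → sym -0#≈0# }
  Δ²-skew (suc r) = ▷-skew _ (▷-skew _ (Skew-map (pair-map below) (Δ²-skew r)))

  PairScaled : ∀ {r} → K → Column r × Column r → Column r × Column r → Set ℓ
  PairScaled k (t , b) (t′ , b′) = (t ≋ k · t′) × (b ≋ k · b′)

  Δ²-scaling : ∀ r k → Scaling (PairScaled k) k (Δ² r)
  Δ²-scaling zero    k = scaling λ { [] _ _ → sym (zeroʳ k) ; (_ ∷ _) _ _ → sym (zeroʳ k) }
  Δ²-scaling (suc r) k = ▷-scaling (λ p → proj₁ p zero) (▷-scaling (λ p → proj₂ p zero)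
    (Scaling-map (pair-map below) (λ (p , q) → p ∘ suc , q ∘ suc) (Δ²-scaling r k)))

  -- The parity of the permutation of the rows T₁, …, T_r, B₁, …, B_r to the order in Δ².
  rowSign : ℕ → ℕ
  rowSign zero    = 0
  rowSign (suc r) = r ℕ.+ rowSign r

  -- The top row of the second factor passes the `r` remaining rows of the first one, whence `sg r`
  -- at each level. The interleaved order of `Δ²` puts the two rows mixed by `shear` next to each
  -- other.
  Δ⊛Δ : ∀ r cs → (Δ r ⊛ Δ r) cs ≈ sg (rowSign r) * Δ² r cs
  Δ⊛Δ zero []       = refl
  Δ⊛Δ zero (_ ∷ cs) = begin
    _ + _    ≈⟨ +-cong (⊛-zeroˡ (λ _ → refl) cs) (⊛-zeroʳ (λ _ → refl) cs) ⟩
    0# + 0#  ≈⟨ +-identityˡ _ ⟩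
    0#       ≈⟨ zeroʳ _ ⟨
    _        ∎
  Δ⊛Δ (suc r) cs = begin
    ((top ▷ δ) ⊛ (top ▷ δ)) cs
      ≈⟨ ▷-⊛ top δ (top ▷ δ) cs ⟩
    (top₁ ▷ (δ ⊛ (top ▷ δ))) cs
      ≈⟨ ▷-congʳ (⊛-▷ top δ δ) cs ⟩
    (top₁ ▷ top₂ ▷ (involute δ ⊛ δ)) cs
      ≈⟨ ▷-congʳ (▷-congʳ λ l → trans (⊛-cong (involute-degree (Degree-map below (Δ-degree r))) (λ _ → refl) l) (⊛-*ˡ _ δ δ l)) cs ⟩
    (top₁ ▷ top₂ ▷ (λ l → sg r * (δ ⊛ δ) l)) cs
      ≈⟨ ▷-congʳ (▷-congʳ λ l → *-congˡ (trans (⊛-map below (Δ r) (Δ r) l) (Δ⊛Δ r _))) cs ⟩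
    (top₁ ▷ top₂ ▷ (λ l → sg r * (sg (rowSign r) * Δ² r (map (pair-map below) l)))) cs
      ≈⟨ ▷-congʳ (▷-congʳ λ l → trans (sym (*-assoc _ _ _)) (*-congʳ (sym (sg-+ r _)))) cs ⟩
    (top₁ ▷ top₂ ▷ (λ l → sg (r ℕ.+ rowSign r) * Δ² r (map (pair-map below) l))) cs
      ≈⟨ trans (▷-congʳ (▷-* top₂ _ _) cs) (▷-* top₁ _ _ cs) ⟩
    sg (rowSign (suc r)) * Δ² (suc r) cs ∎
    where
    δ = Δ r ∘ map below
    top₁ top₂ : Column (suc r) × Column (suc r) → K
    top₁ = top ∘ proj₁
    top₂ = top ∘ proj₂

  shear : ∀ {r} → Column r × Column r → Column r × Column r
  shear (t , b) = (λ i → t i + - b i) , t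

  -- The matrix of shear has determinant 1; on each pair of rows the invariance reads
  -- (φ − ψ) ∧ φ = φ ∧ ψ.
  Δ²-shear : ∀ r cs → Δ² r (map shear cs) ≈ Δ² r cs
  Δ²-shear zero []      = refl
  Δ²-shear zero (_ ∷ _) = refl
  Δ²-shear (suc r) cs = begin
    (φ ▷ ψ ▷ δ) (map shear cs)
      ≈⟨ ▷-map shear φ _ cs ⟩
    ((φ ∘ shear) ▷ ((ψ ▷ δ) ∘ map shear)) cs
      ≈⟨ ▷-congʳ (▷-map shear ψ δ) cs ⟩
    ((φ ∘ shear) ▷ φ ▷ (δ ∘ map shear)) cs
      ≈⟨ ▷-congʳ (▷-congʳ inner) cs ⟩
    ((λ c → φ c + - ψ c) ▷ φ ▷ δ) cs
      ≈⟨ ▷-difference φ ψ _ cs ⟩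
    (φ ▷ φ ▷ δ) cs + - (ψ ▷ φ ▷ δ) cs
      ≈⟨ +-cong (▷-square φ δ cs) (sym (▷-anticomm φ ψ δ cs)) ⟩
    0# + (φ ▷ ψ ▷ δ) cs
      ≈⟨ +-identityˡ _ ⟩
    (φ ▷ ψ ▷ δ) cs ∎
    where
    φ ψ : Column (suc r) × Column (suc r) → K
    φ = top ∘ proj₁
    ψ = top ∘ proj₂
    δ = Δ² r ∘ map (pair-map below)
    commute : ∀ l → map (pair-map below) (map shear l) ≡ map shear (map (pair-map below) l)
    commute []      = ≡.refl
    commute (_ ∷ l) = ≡.cong (_ ∷_) (commute l)
    inner : ∀ l → δ (map shear l) ≈ δ l
    inner l = trans (reflexive (≡.cong (Δ² r) (commute l))) (Δ²-shear r _)

-- Identification of `detL` with the iterated form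

module Determinant {a ℓ} (F : Field a ℓ) where
  open Field F hiding (zero) renaming (Carrier to K)
  open FieldOps F
  open ExteriorForms commutativeRing
  open import Algebra.Properties.Ring ring
  open import Relation.Binary.Reasoning.Setoid setoid

  detL≈Δ : ∀ r cs → detL r cs ≈ Δ r cs

  -- The value of the loop in `detL` as a function of its state: `pre` holds the columns already
  -- passed and `s` the running sign.
  cofactors : ∀ {r} → List (Column (suc r)) → List (Column (suc r)) → K → K
  cofactors {r} pre post s = s * (top ▷ (λ l → Δ r (map below (pre ++ l)))) post

  -- `pre` and `s` are tied to the state of the loop by equations, so that the `with` can abstract
  -- that state to variables and the equations can then be matched.
  detL-∷ : ∀ {r} c cs {pre s} → pre ≡ [ c ] → s ≡ - 1# →
    detL (suc r) (c ∷ cs) ≈ 1# * c zero * detL r (map below cs) + cofactors pre cs s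

  -- The left-hand side is the loop local to detL, which cannot be named: it is inferred from the use
  -- of this lemma in detL-∷, where the arguments of the loop have been abstracted to variables.
  loop≈cofactors : ∀ r (whole pre post : List (Column (suc r))) s → _ ≈ cofactors pre post s

  detL-∷ {r} c cs p q with c ∷ cs | - 1# | [ c ]
  detL-∷ {r} c cs ≡.refl ≡.refl | whole | s | pre = +-congˡ (loop≈cofactors r whole pre cs s)

  loop≈cofactors r whole pre []         s = sym (zeroʳ s)
  loop≈cofactors r whole pre (c ∷ post) s = begin
    _
      ≈⟨ +-cong (trans (*-congˡ (detL≈Δ r _)) (*-assoc _ _ _)) (loop≈cofactors r whole (pre ++ [ c ]) post (- s)) ⟩
    s * (c zero * Δ r (map below (pre ++ post))) + - s * (top ▷ (λ l → Δ r (map below ((pre ++ [ c ]) ++ l)))) post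
      ≈⟨ +-congˡ (trans (sym (-‿distribˡ-* _ _)) (-‿distribʳ-* _ _)) ⟩
    s * (c zero * Δ r (map below (pre ++ post))) + s * - (top ▷ (λ l → Δ r (map below ((pre ++ [ c ]) ++ l)))) post
      ≈⟨ distribˡ s _ _ ⟨
    s * (c zero * Δ r (map below (pre ++ post)) + - (top ▷ (λ l → Δ r (map below ((pre ++ [ c ]) ++ l)))) post)
      ≈⟨ *-congˡ (+-congˡ (-‿cong (▷-congʳ (λ l → reflexive (≡.cong (Δ r ∘ map below) (++-assoc pre [ c ] l))) post))) ⟩
    cofactors pre (c ∷ post) s ∎

  detL≈Δ zero    []       = refl
  detL≈Δ zero    (_ ∷ _)  = refl
  detL≈Δ (suc r) []       = refl
  detL≈Δ (suc r) (c ∷ cs) = trans (detL-∷ c cs ≡.refl ≡.refl)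
    (+-cong (*-cong (*-identityˡ _) (detL≈Δ r _)) (-1*x≈-x _))

-- Laplace expansion as a sum over subsets

module SubsetSums {a ℓ} (F : Field a ℓ) where
  open Field F hiding (zero) renaming (Carrier to K)
  open FieldOps F
  open ExteriorForms commutativeRing
  open import Algebra.Properties.CommutativeSemigroup +-commutativeSemigroup using () renaming (interchange to +-interchange)
  open import Relation.Binary.Reasoning.Setoid setoid

  when : Bool → K → K
  when b x = if b then x else 0#

  when-cong : ∀ b {x y} → (b ≡ true → x ≈ y) → when b x ≈ when b y
  when-cong true  p = p ≡.refl
  when-cong false p = refl

  when-zero : ∀ b {x} → (b ≡ true → x ≈ 0#) → when b x ≈ 0#
  when-zero true  p = p ≡.refl
  when-zero false p = refl

  when-* : ∀ b k x → when b (k * x) ≈ k * when b x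
  when-* true  k x = refl
  when-* false k x = sym (zeroʳ k)

  module _ {i} {I : Set i} where
    Σ-cong : ∀ (xs : List I) {f g : I → K} → (∀ x → f x ≈ g x) → Σ xs f ≈ Σ xs g
    Σ-cong []       p = refl
    Σ-cong (x ∷ xs) p = +-cong (p x) (Σ-cong xs p)

    Σ-zero : ∀ (xs : List I) {f : I → K} → (∀ x → f x ≈ 0#) → Σ xs f ≈ 0#
    Σ-zero []       p = refl
    Σ-zero (x ∷ xs) p = trans (+-cong (p x) (Σ-zero xs p)) (+-identityˡ _)

    Σ-++ : ∀ (xs ys : List I) (f : I → K) → Σ (xs ++ ys) f ≈ Σ xs f + Σ ys f
    Σ-++ []       ys f = sym (+-identityˡ _)
    Σ-++ (x ∷ xs) ys f = trans (+-congˡ (Σ-++ xs ys f)) (sym (+-assoc _ _ _))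

    Σ-+ : ∀ (xs : List I) (f g : I → K) → Σ xs (λ x → f x + g x) ≈ Σ xs f + Σ xs g
    Σ-+ []       f g = sym (+-identityˡ _)
    Σ-+ (x ∷ xs) f g = trans (+-congˡ (Σ-+ xs f g)) (+-interchange _ _ _ _)

    Σ-*ˡ : ∀ k (xs : List I) (f : I → K) → Σ xs (λ x → k * f x) ≈ k * Σ xs f
    Σ-*ˡ k []       f = sym (zeroʳ k)
    Σ-*ˡ k (x ∷ xs) f = trans (+-congˡ (Σ-*ˡ k xs f)) (sym (distribˡ k _ _))

    Σ-map : ∀ {j} {J : Set j} (h : J → I) xs (f : I → K) → Σ (map h xs) f ≡ Σ xs (f ∘ h)
    Σ-map h []       f = ≡.refl
    Σ-map h (x ∷ xs) f = ≡.cong (λ s → f (h x) + s) (Σ-map h xs f)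

  Σ-swap : ∀ {i j} {I : Set i} {J : Set j} (xs : List I) (ys : List J) (f : I → J → K) →
    Σ xs (λ x → Σ ys (f x)) ≈ Σ ys (λ y → Σ xs (λ x → f x y))
  Σ-swap []       ys f = sym (Σ-zero ys (λ _ → refl))
  Σ-swap (x ∷ xs) ys f = trans (+-congˡ (Σ-swap xs ys f)) (sym (Σ-+ ys _ _))

  Σ-allSubsets-suc : ∀ n (f : Subset (suc n) → K) →
    Σ (allSubsets (suc n)) f ≈ Σ (allSubsets n) (f ∘ (inside ∷_)) + Σ (allSubsets n) (f ∘ (outside ∷_))
  Σ-allSubsets-suc n f = trans (Σ-++ (map (inside ∷_) (allSubsets n)) _ f)
    (+-cong (reflexive (Σ-map (inside ∷_) (allSubsets n) f)) (reflexive (Σ-map (outside ∷_) (allSubsets n) f)))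

  module _ {c} {X : Set c} where

    -- Laplace expansion: V collects the columns of B given to `f`, and the degree of `f` forces |V|
    -- = |ws|. In `g`, each chosen position is filled by the next entry of `ws`, so the arguments
    -- come out in the order of B; the signs of this reordering cancel those of the expansion, and
    -- none are left in the sum.
    exchange-sum : ∀ {n} (B : Subset n) (t b : Fin n → X) {f g} ws → Skew g → Degree (length ws) f →
      (f ⊛ (λ l → g (ws ++ l))) (pick B (λ j → t j , b j))
        ≈ Σ (allSubsets n) λ V → when (V ⊆ᵇ B ∧ (∣ V ∣ ≡ᵇ length ws)) (f (pick V t) * g (substitute B V b ws))
    exchange-sum [] t b [] s d = sym (+-identityʳ _)
    exchange-sum [] t b (w ∷ ws) s d = begin
      _         ≈⟨ *-congʳ (off-degree d [] λ ()) ⟩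
      0# * _    ≈⟨ zeroˡ _ ⟩
      0#        ≈⟨ +-identityʳ _ ⟨
      0# + 0#   ∎
    exchange-sum {suc n} (outside ∷ B) t b {f} {g} ws s d = begin
      _         ≈⟨ exchange-sum B (t ∘ suc) (b ∘ suc) ws s d ⟩
      _         ≈⟨ +-identityˡ _ ⟨
      0# + _    ≈⟨ +-congʳ (Σ-zero (allSubsets n) (λ _ → refl)) ⟨
      _ + _     ≈⟨ Σ-allSubsets-suc n _ ⟨
      _         ∎
    exchange-sum {suc n} (inside ∷ B) t b {f} {g} ws s d = begin
      _ ≈⟨ +-cong (chosen ws d) (unchosen) ⟩
      _ ≈⟨ Σ-allSubsets-suc n _ ⟨
      _ ∎
      where
      rest = pick B (λ j → t (suc j) , b (suc j))
      chosen : ∀ ws → Degree (length ws) f → ((f ∘ (t zero ∷_)) ⊛ (λ l → g (ws ++ l))) rest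
        ≈ Σ (allSubsets n) λ V → when (V ⊆ᵇ B ∧ (suc ∣ V ∣ ≡ᵇ length ws)) (f (t zero ∷ pick V (t ∘ suc)) * g (substitute (inside ∷ B) (inside ∷ V) b ws))
      chosen [] d = trans
        (⊛-zeroˡ (λ l → off-degree d (t zero ∷ l) λ ()) rest)
        (sym (Σ-zero (allSubsets n) λ V → when-zero (V ⊆ᵇ B ∧ false) λ _ → trans (*-congʳ (off-degree d _ λ ())) (zeroˡ _)))
      chosen (w ∷ ws) d = exchange-sum B (t ∘ suc) (b ∘ suc) ws (Skew-∷ s w) (Degree-∷ d (t zero))
      unchosen : (involute f ⊛ (λ l → g (ws ++ b zero ∷ l))) rest
        ≈ Σ (allSubsets n) λ V → when (V ⊆ᵇ B ∧ (∣ V ∣ ≡ᵇ length ws)) (f (pick V (t ∘ suc)) * g (b zero ∷ substitute B V (b ∘ suc) ws))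
      unchosen = begin
        -- Two equal signs: `b zero` passes the |ws| arguments still due to `f`, and inside `g` it
        -- passes `ws` itself.
        _ ≈⟨ ⊛-cong (involute-degree d) (λ l → Skew-move⁻ s (b zero) ws l) rest ⟩
        _ ≈⟨ trans (⊛-*ˡ _ _ _ rest) (*-congˡ (⊛-*ʳ _ _ _ rest)) ⟩
        _ ≈⟨ sg-cancel (length ws) _ ⟩
        _ ≈⟨ exchange-sum B (t ∘ suc) (b ∘ suc) ws (Skew-∷ s (b zero)) d ⟩
        _ ∎

    -- To reach its position, each entry of `vs` moves left past the columns of `A ─ U` that come
    -- after that position.
    sort : ∀ {n} (A U : Subset n) (h : Fin n → X) {f} vs post → Skew f → U ⊆ᵇ A ≡ true → length vs ≡ ∣ U ∣ →
      f (pick (A ─ U) h ++ vs ++ post) ≈ sg (inversions A U) * f (substitute A U h vs ++ post)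
    sort []            []            h []       post s p q = sym (*-identityˡ _)
    sort (inside ∷ A)  (outside ∷ U) h vs       post s p q = sort A U (h ∘ suc) vs post (Skew-∷ s (h zero)) p q
    sort (outside ∷ A) (outside ∷ U) h vs       post s p q = sort A U (h ∘ suc) vs post s p q
    sort (inside ∷ A)  (inside ∷ U)  h {f} (v ∷ vs) post s p q = begin
      f (P ++ v ∷ vs ++ post)
        ≈⟨ Skew-move⁻ s v P _ ⟩
      sg (length P) * f (v ∷ P ++ vs ++ post)
        ≈⟨ *-cong (reflexive (≡.cong sg (length-pick (A ─ U) _))) (sort A U (h ∘ suc) vs post (Skew-∷ s v) p (ℕ.suc-injective q)) ⟩
      sg ∣ A ─ U ∣ * (sg (inversions A U) * f (v ∷ substitute A U (h ∘ suc) vs ++ post))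
        ≈⟨ *-assoc _ _ _ ⟨
      sg ∣ A ─ U ∣ * sg (inversions A U) * f (v ∷ substitute A U (h ∘ suc) vs ++ post)
        ≈⟨ *-congʳ (sg-+ ∣ A ─ U ∣ _) ⟨
      _ ∎
      where P = pick (A ─ U) (h ∘ suc)

    record Vanishing (z : X) (f : List X → K) : Set (c ⊔ ℓ) where
      constructor vanishing
      field null : ∀ pre post → f (pre ++ z ∷ post) ≈ 0#
    open Vanishing public

    Vanishing-∷ : ∀ {z f} → Vanishing z f → ∀ x → Vanishing z (f ∘ (x ∷_))
    Vanishing-∷ v x = vanishing λ pre → null v (x ∷ pre)

    Vanishing-++ : ∀ {z f} → Vanishing z f → ∀ xs → Vanishing z (f ∘ (xs ++_))
    Vanishing-++ v []       = v
    Vanishing-++ v (x ∷ xs) = Vanishing-++ (Vanishing-∷ v x) xs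

    forced-left : ∀ {z f g} → Vanishing z g → ∀ {n} (S : Subset n) h cs →
      (f ⊛ g) (pick S (λ j → h j , z) ++ cs) ≈ ((f ∘ (pick S h ++_)) ⊛ g) cs
    forced-left v []            h cs = refl
    forced-left v (outside ∷ S) h cs = forced-left v S (h ∘ suc) cs
    forced-left v (inside ∷ S)  h cs = trans
      (+-cong (forced-left v S (h ∘ suc) cs) (⊛-zeroʳ (null v []) (pick S _ ++ cs))) (+-identityʳ _)

    -- Each column passed to `g` crosses the `d` arguments that `f` is still to receive.
    forced-right : ∀ {z f g d} → Vanishing z f → Degree d f → ∀ {n} (S : Subset n) h cs →
      (f ⊛ g) (pick S (λ j → z , h j) ++ cs) ≈ sg (∣ S ∣ ℕ.* d) * (f ⊛ (g ∘ (pick S h ++_))) cs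
    forced-right v e []            h cs = sym (*-identityˡ _)
    forced-right v e (outside ∷ S) h cs = forced-right v e S (h ∘ suc) cs
    forced-right {z} {f} {g} {d} v e (inside ∷ S) h cs = begin
      ((f ∘ (z ∷_)) ⊛ g) rest + (involute f ⊛ (g ∘ (h zero ∷_))) rest
        ≈⟨ +-cong (⊛-zeroˡ (null v []) rest) (trans (⊛-cong (involute-degree e) (λ _ → refl) rest) (⊛-*ˡ _ _ _ rest)) ⟩
      0# + sg d * (f ⊛ (g ∘ (h zero ∷_))) rest
        ≈⟨ +-identityˡ _ ⟩
      sg d * (f ⊛ (g ∘ (h zero ∷_))) rest
        ≈⟨ *-congˡ (forced-right v e S (h ∘ suc) cs) ⟩
      sg d * (sg (∣ S ∣ ℕ.* d) * _)
        ≈⟨ *-assoc _ _ _ ⟨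
      sg d * sg (∣ S ∣ ℕ.* d) * _
        ≈⟨ *-congʳ (sg-+ d _) ⟨
      _ ∎
      where rest = pick S (λ j → z , h (suc j)) ++ cs

-- The exchange identity for determinants

module ExchangeIdentity {a ℓ} (F : Field a ℓ) where
  open Field F hiding (zero) renaming (Carrier to K)
  open FieldOps F
  open ExteriorForms commutativeRing
  open SubsetSums F
  open Determinant F
  open import Algebra.Properties.Ring ring
  open import Relation.Binary.Reasoning.Setoid setoid

  module _ {c} {X : Set c} {z : X} where

    pick-clip-null : ∀ {n} (V S : Subset n) h {f} → Vanishing z f → V ⊆ᵇ S ≡ false → f (pick V (clip z S h)) ≈ 0#
    pick-clip-null (outside ∷ V) (_ ∷ S)       h v p = pick-clip-null V S (h ∘ suc) v p
    pick-clip-null (inside ∷ V)  (outside ∷ S) h v p = null v [] _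
    pick-clip-null (inside ∷ V)  (inside ∷ S)  h v p = pick-clip-null V S (h ∘ suc) (Vanishing-∷ v (h zero)) p
    pick-clip-null []            []            h v ()

    -- An element of `S` outside `V` keeps its own column, and this is clipped to `z`.
    substitute-clip-null : ∀ {n} (B V S : Subset n) h ws {f} → Vanishing z f →
      V ⊆ᵇ B ≡ true → S ⊆ᵇ B ≡ true → S ⊆ᵇ V ≡ false → length ws ≡ ∣ V ∣ →
      f (substitute B V (clip z (∁ S) h) ws) ≈ 0#
    substitute-clip-null []            []            []            h ws       v o o′ () q
    substitute-clip-null (inside ∷ B)  (outside ∷ V) (inside ∷ S)  h ws       v o o′ p q = null v [] _
    substitute-clip-null (inside ∷ B)  (outside ∷ V) (outside ∷ S) h ws       v o o′ p q = substitute-clip-null B V S (h ∘ suc) ws (Vanishing-∷ v _) o o′ p q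
    substitute-clip-null (inside ∷ B)  (inside ∷ V)  (inside ∷ S)  h (w ∷ ws) v o o′ p q = substitute-clip-null B V S (h ∘ suc) ws (Vanishing-∷ v _) o o′ p (ℕ.suc-injective q)
    substitute-clip-null (inside ∷ B)  (inside ∷ V)  (outside ∷ S) h (w ∷ ws) v o o′ p q = substitute-clip-null B V S (h ∘ suc) ws (Vanishing-∷ v _) o o′ p (ℕ.suc-injective q)
    substitute-clip-null (outside ∷ B) (outside ∷ V) (outside ∷ S) h ws       v o o′ p q = substitute-clip-null B V S (h ∘ suc) ws v o o′ p q

  𝟎 : ∀ {r} → Column r
  𝟎 _ = 0#

  Δ-vanishing : ∀ r → Vanishing 𝟎 (Δ r)
  Δ-vanishing r = vanishing λ pre post → trans (scale (Δ-scaling r 0#) pre {𝟎} {𝟎} post (λ _ → sym (zeroˡ _))) (zeroˡ _)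

  sg-n*n : ∀ n → sg (n ℕ.* n) ≈ sg n
  sg-n*n zero    = refl
  sg-n*n (suc n) = -‿cong (begin
    sg (n ℕ.+ n ℕ.* suc n)              ≡⟨ ≡.cong (λ k → sg (n ℕ.+ k)) (ℕ.*-suc n n) ⟩
    sg (n ℕ.+ (n ℕ.+ n ℕ.* n))          ≈⟨ trans (sg-+ n _) (*-congˡ (sg-+ n _)) ⟩
    sg n * (sg n * sg (n ℕ.* n))        ≈⟨ sg-cancel n _ ⟩
    sg (n ℕ.* n)                        ≈⟨ sg-n*n n ⟩
    sg n                                ∎)

  module _ {r n : ℕ} (col : Fin n → Column r) where

    exchanged : (A B U V : Subset n) → K
    exchanged A B U V = Δ r (substitute A U col (pick V col)) * Δ r (substitute B V col (pick U col))

    upper lower : Fin n → Column r × Column r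
    upper j = col j , 𝟎
    lower j = 𝟎 , col j

    -- With these columns of B, only the V with Lo ⊆ V ⊆ Hi contribute to the expansion.
    between : (Lo Hi : Subset n) → Fin n → Column r × Column r
    between Lo Hi j = clip 𝟎 Hi col j , clip 𝟎 (∁ Lo) col j

    -- The columns of `A ─ U` are forced into the first factor, which leaves |U| places there. The
    -- |U| columns forced into the second factor each cross these places, giving |U|² ≡ |U| modulo
    -- 2; the inversions come from sorting V into the positions of U.
    partial-exchange-sum : ∀ (A B U Lo Hi : Subset n) → ∣ A ∣ ≡ r → U ⊆ᵇ A ≡ true → Lo ⊆ᵇ B ≡ true →
      (Δ r ⊛ Δ r) (pick (A ─ U) upper ++ pick U lower ++ pick B (between Lo Hi))
        ≈ sg (∣ U ∣ ℕ.+ inversions A U)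
          * Σ (allSubsets n) λ V → when (V ⊆ᵇ B ∧ (∣ V ∣ ≡ᵇ ∣ U ∣)) (when (Lo ⊆ᵇ V ∧ V ⊆ᵇ Hi) (exchanged A B U V))
    partial-exchange-sum A B U Lo Hi ∣A∣ U⊆A Lo⊆B = begin
      (Δ r ⊛ Δ r) (pick (A ─ U) upper ++ pick U lower ++ bs)
        ≈⟨ forced-left (Δ-vanishing r) (A ─ U) col _ ⟩
      ((Δ r ∘ (P ++_)) ⊛ Δ r) (pick U lower ++ bs)
        ≈⟨ forced-right (Vanishing-++ (Δ-vanishing r) P) deg U col bs ⟩
      sg (∣ U ∣ ℕ.* ∣ U ∣) * ((Δ r ∘ (P ++_)) ⊛ (Δ r ∘ (W ++_))) bs
        ≈⟨ *-cong (sg-n*n ∣ U ∣) (exchange-sum B _ _ W (Δ-skew r) (≡.subst (λ k → Degree k (Δ r ∘ (P ++_))) (≡.sym (length-pick U col)) deg)) ⟩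
      sg ∣ U ∣ * Σ (allSubsets n) (λ V → when (V ⊆ᵇ B ∧ (∣ V ∣ ≡ᵇ length W)) (Δ r (P ++ pick V t) * Δ r (substitute B V b W)))
        ≈⟨ *-congˡ (Σ-cong (allSubsets n) term) ⟩
      sg ∣ U ∣ * Σ (allSubsets n) (λ V → sg (inversions A U) * when (V ⊆ᵇ B ∧ (∣ V ∣ ≡ᵇ ∣ U ∣)) (when (Lo ⊆ᵇ V ∧ V ⊆ᵇ Hi) (exchanged A B U V)))
        ≈⟨ *-congˡ (Σ-*ˡ _ (allSubsets n) _) ⟩
      sg ∣ U ∣ * (sg (inversions A U) * _)
        ≈⟨ *-assoc _ _ _ ⟨
      sg ∣ U ∣ * sg (inversions A U) * _
        ≈⟨ *-congʳ (sg-+ ∣ U ∣ _) ⟨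
      _ ∎
      where
      P = pick (A ─ U) col
      W = pick U col
      t = clip 𝟎 Hi col
      b = clip 𝟎 (∁ Lo) col
      bs = pick B (between Lo Hi)
      deg : Degree ∣ U ∣ (Δ r ∘ (P ++_))
      deg = Degree-++ P (≡.subst (λ k → Degree k (Δ r))
        (≡.trans (≡.sym ∣A∣) (≡.trans (≡.sym (∣p─q∣+∣q∣≡∣p∣ A U U⊆A)) (≡.cong (ℕ._+ ∣ U ∣) (≡.sym (length-pick (A ─ U) col)))))
        (Δ-degree r))
      value : ∀ V → V ⊆ᵇ B ≡ true → ∣ V ∣ ≡ ∣ U ∣ →
        Δ r (P ++ pick V t) * Δ r (substitute B V b W) ≈ sg (inversions A U) * when (Lo ⊆ᵇ V ∧ V ⊆ᵇ Hi) (exchanged A B U V)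
      value V V⊆B eq with Lo ⊆ᵇ V in lo | V ⊆ᵇ Hi in hi
      ... | false | _     = trans
        (trans (*-congˡ (substitute-clip-null B V Lo col W (Δ-vanishing r) V⊆B Lo⊆B lo (≡.trans (length-pick U col) (≡.sym eq)))) (zeroʳ _))
        (sym (zeroʳ _))
      ... | true  | false = trans
        (trans (*-congʳ (pick-clip-null V Hi col (Vanishing-++ (Δ-vanishing r) P) hi)) (zeroˡ _))
        (sym (zeroʳ _))
      ... | true  | true  = begin
        Δ r (P ++ pick V t) * Δ r (substitute B V b W)
          ≡⟨ ≡.cong₂ (λ x y → Δ r (P ++ x) * Δ r y) (pick-clip 𝟎 V Hi col hi)
               (substitute-clip 𝟎 B V Lo col W V⊆B lo (≡.trans (length-pick U col) (≡.sym eq))) ⟩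
        Δ r (P ++ pick V col) * Δ r (substitute B V col W)
          ≡⟨ ≡.cong (λ x → Δ r (P ++ x) * Δ r (substitute B V col W)) (++-identityʳ (pick V col)) ⟨
        Δ r (P ++ pick V col ++ []) * Δ r (substitute B V col W)
          ≈⟨ *-congʳ (sort A U col (pick V col) [] (Δ-skew r) U⊆A (≡.trans (length-pick V col) eq)) ⟩
        sg (inversions A U) * Δ r (substitute A U col (pick V col) ++ []) * Δ r (substitute B V col W)
          ≡⟨ ≡.cong (λ x → sg (inversions A U) * Δ r x * Δ r (substitute B V col W)) (++-identityʳ (substitute A U col (pick V col))) ⟩
        sg (inversions A U) * Δ r (substitute A U col (pick V col)) * Δ r (substitute B V col W)
          ≈⟨ *-assoc _ _ _ ⟩
        sg (inversions A U) * exchanged A B U V ∎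
      term : ∀ V → when (V ⊆ᵇ B ∧ (∣ V ∣ ≡ᵇ length W)) (Δ r (P ++ pick V t) * Δ r (substitute B V b W))
        ≈ sg (inversions A U) * when (V ⊆ᵇ B ∧ (∣ V ∣ ≡ᵇ ∣ U ∣)) (when (Lo ⊆ᵇ V ∧ V ⊆ᵇ Hi) (exchanged A B U V))
      term V rewrite length-pick U col = trans
        (when-cong (V ⊆ᵇ B ∧ (∣ V ∣ ≡ᵇ ∣ U ∣)) λ p → value V (proj₁ (∧-true p)) (≡ᵇ-true (proj₂ (∧-true {V ⊆ᵇ B} p))))
        (when-* (V ⊆ᵇ B ∧ (∣ V ∣ ≡ᵇ ∣ U ∣)) _ _)

  infix 4 _≈[_]_
  -- Keeping the exponent in ℕ makes signs additive under composition, so that the total parity is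
  -- settled by one identity of natural numbers.
  _≈[_]_ : K → ℕ → K → Set ℓ
  x ≈[ n ] y = x ≈ sg n * y

  signed-trans : ∀ {x y z m n} → x ≈[ m ] y → y ≈[ n ] z → x ≈[ m ℕ.+ n ] z
  signed-trans {m = m} {n} p q = trans p (trans (*-congˡ q) (trans (sym (*-assoc _ _ _)) (*-congʳ (sym (sg-+ m n)))))

  signed-sym : ∀ {x y n} → x ≈[ n ] y → y ≈[ n ] x
  signed-sym {n = n} p = trans (sym (sg-cancel n _)) (*-congˡ (sym p))

  sg-even : ∀ m r → sg (m ℕ.+ m ℕ.+ (r ℕ.* r ℕ.+ r)) ≈ 1#
  sg-even m r = begin
    sg (m ℕ.+ m ℕ.+ (r ℕ.* r ℕ.+ r))                ≈⟨ trans (sg-+ (m ℕ.+ m) _) (*-cong (sg-+ m m) (sg-+ (r ℕ.* r) r)) ⟩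
    sg m * sg m * (sg (r ℕ.* r) * sg r)             ≈⟨ *-cong (sg-square m) (trans (*-congʳ (sg-n*n r)) (sg-square r)) ⟩
    1# * 1#                                         ≈⟨ *-identityˡ _ ⟩
    1#                                              ∎

  module _ {r n : ℕ} (col : Fin n → Column r) (A B U Y : Subset n)
    (∣A∣ : ∣ A ∣ ≡ r) (∣B∣ : ∣ B ∣ ≡ r) (U⊆A : U ⊆ᵇ A ≡ true) (Y⊆B : Y ⊆ᵇ B ≡ true) where

    -- Over B the elements of Y become (v, 0), forcing Y ⊆ V; over A the elements of `A ─ U` become
    -- (0, v), forcing W ⊆ U. All other elements are (v, v).
    exchangeable-from-B exchangeable-from-A : Fin n → Column r × Column r
    exchangeable-from-B = between col Y B
    exchangeable-from-A = between col ⊥ U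

    -- The shear takes (v, 0) to (v, v), (0, v) to -(v, 0) and (v, v) to (0, v). This and the next
    -- three statements record it on the four blocks; Y and `A ─ U` are the ones that change sign.
    shear-B─Y : ∀ j → lookup (B ─ Y) j ≡ inside → PairScaled 1# (shear (upper col j)) (exchangeable-from-B j)
    shear-B─Y j p with lookup B j | lookup (∁ Y) j | proj₁ (lookup-─ B Y j p)
      | ≡.trans (lookup-map j not Y) (≡.cong not (proj₂ (lookup-─ B Y j p)))
    ... | _ | _ | ≡.refl | ≡.refl =
      (λ i → trans (trans (+-congˡ -0#≈0#) (+-identityʳ _)) (sym (*-identityˡ _))) , (λ i → sym (*-identityˡ _))

    shear-Y : ∀ j → lookup Y j ≡ inside → PairScaled (- 1#) (shear (lower col j)) (exchangeable-from-B j)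
    shear-Y j p with lookup B j | lookup (∁ Y) j | ⊆ᵇ-lookup Y B j Y⊆B p | ≡.trans (lookup-map j not Y) (≡.cong not p)
    ... | _ | _ | ≡.refl | ≡.refl =
      (λ i → trans (+-identityˡ _) (sym (-1*x≈-x _))) , (λ i → sym (zeroʳ _))

    shear-A─U : ∀ j → lookup (A ─ U) j ≡ inside → PairScaled (- 1#) (shear (exchangeable-from-A j)) (upper col j)
    shear-A─U j p with lookup U j | lookup (∁ ⊥) j | proj₂ (lookup-─ A U j p)
      | ≡.trans (lookup-map {n = n} j not ⊥) (≡.cong not (lookup-replicate j outside))
    ... | _ | _ | ≡.refl | ≡.refl =
      (λ i → trans (+-identityˡ _) (sym (-1*x≈-x _))) , (λ i → sym (zeroʳ _))

    shear-U : ∀ j → lookup U j ≡ inside → PairScaled 1# (shear (exchangeable-from-A j)) (lower col j)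
    shear-U j p with lookup U j | lookup (∁ ⊥) j | p
      | ≡.trans (lookup-map {n = n} j not ⊥) (≡.cong not (lookup-replicate j outside))
    ... | _ | _ | ≡.refl | ≡.refl =
      (λ i → trans (-‿inverseʳ _) (sym (zeroʳ _))) , (λ i → sym (*-identityˡ _))

    Δ²-sort : ∀ (A U : Subset n) (h : Fin n → Column r × Column r) post → U ⊆ᵇ A ≡ true →
      Δ² r (pick (A ─ U) h ++ pick U h ++ post) ≈[ inversions A U ] Δ² r (pick A h ++ post)
    Δ²-sort A U h post p = trans
      (sort A U h (pick U h) post (Δ²-skew r) p (length-pick U h))
      (*-congˡ (reflexive (≡.cong (λ l → Δ² r (l ++ post)) (substitute-self A U h p))))

    -- Origin of the exponent: |Y| and |A ─ U| count the columns negated by the shear, the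
    -- inversions come from merging `B ─ Y` with Y and from splitting A, and r · r from
    -- interchanging the two blocks of r columns.
    Δ²-exchange :
      Δ² r (pick (B ─ Y) (upper col) ++ pick Y (lower col) ++ pick A exchangeable-from-A)
        ≈[ ∣ Y ∣ ℕ.+ inversions B Y ℕ.+ r ℕ.* r ℕ.+ (inversions A U ℕ.+ ∣ A ─ U ∣) ]
      Δ² r (pick (A ─ U) (upper col) ++ pick U (lower col) ++ pick B exchangeable-from-B)
    Δ²-exchange = begin
      Δ² r (pick (B ─ Y) (upper col) ++ pick Y (lower col) ++ pick A exchangeable-from-A)
        ≈⟨ Δ²-shear r _ ⟨
      Δ² r (map shear (pick (B ─ Y) (upper col) ++ pick Y (lower col) ++ pick A exchangeable-from-A))
        ≡⟨ ≡.cong (Δ² r) sheared ⟩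
      Δ² r (pick (B ─ Y) (shear ∘ upper col) ++ pick Y (shear ∘ lower col) ++ pick A sA)
        ≈⟨ scale-one (Δ²-scaling r 1#) _ (pick-pointwise (B ─ Y) shear-B─Y) ⟩
      Δ² r (pick (B ─ Y) sB ++ pick Y (shear ∘ lower col) ++ pick A sA)
        ≈⟨ signed-trans {m = ∣ Y ∣ ℕ.+ inversions B Y ℕ.+ r ℕ.* r} (signed-trans {m = ∣ Y ∣ ℕ.+ inversions B Y} (signed-trans {m = ∣ Y ∣}
             negate-Y
             (Δ²-sort B Y sB (pick A sA) Y⊆B))
             swap-blocks)
             (signed-trans {m = inversions A U} (signed-sym {n = inversions A U} (Δ²-sort A U sA (pick B sB) U⊆A)) negate-A─U) ⟩
      _ * Δ² r (pick (A ─ U) (upper col) ++ pick U sA ++ pick B sB)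
        ≈⟨ *-congˡ (scale-one (scaling-++ (Δ²-scaling r 1#) (pick (A ─ U) (upper col))) _ (pick-pointwise U shear-U)) ⟩
      _ * Δ² r (pick (A ─ U) (upper col) ++ pick U (lower col) ++ pick B sB) ∎
      where
      sA sB : Fin n → Column r × Column r
      sA = shear ∘ exchangeable-from-A
      sB = exchangeable-from-B
      sheared : map shear (pick (B ─ Y) (upper col) ++ pick Y (lower col) ++ pick A exchangeable-from-A)
        ≡ pick (B ─ Y) (shear ∘ upper col) ++ pick Y (shear ∘ lower col) ++ pick A sA
      sheared = ≡.trans (map-++ shear (pick (B ─ Y) (upper col)) _)
        (≡.cong₂ _++_ (map-pick shear (B ─ Y) _) (≡.trans (map-++ shear (pick Y (lower col)) _)
          (≡.cong₂ _++_ (map-pick shear Y _) (map-pick shear A _))))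
      scaling-++ : ∀ {k f} → Scaling (PairScaled {r} k) k f → ∀ xs → Scaling (PairScaled k) k (f ∘ (xs ++_))
      scaling-++ s []       = s
      scaling-++ s (x ∷ xs) = scaling-++ (Scaling-∷ s x) xs
      negate-Y : Δ² r (pick (B ─ Y) sB ++ pick Y (shear ∘ lower col) ++ pick A sA) ≈[ ∣ Y ∣ ]
        Δ² r (pick (B ─ Y) sB ++ pick Y sB ++ pick A sA)
      negate-Y = trans (scale-neg (scaling-++ (Δ²-scaling r (- 1#)) (pick (B ─ Y) sB)) _ (pick-pointwise Y shear-Y))
        (*-congʳ (reflexive (≡.cong sg (length-pick Y sB))))
      negate-A─U : Δ² r (pick (A ─ U) sA ++ pick U sA ++ pick B sB) ≈[ ∣ A ─ U ∣ ]
        Δ² r (pick (A ─ U) (upper col) ++ pick U sA ++ pick B sB)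
      negate-A─U = trans (scale-neg (Δ²-scaling r (- 1#)) _ (pick-pointwise (A ─ U) shear-A─U))
        (*-congʳ (reflexive (≡.cong sg (length-pick (A ─ U) (upper col)))))
      swap-blocks : Δ² r (pick B sB ++ pick A sA) ≈[ r ℕ.* r ] Δ² r (pick A sA ++ pick B sB)
      swap-blocks = begin
        Δ² r (pick B sB ++ pick A sA)
          ≡⟨ ≡.cong (λ l → Δ² r (pick B sB ++ l)) (++-identityʳ (pick A sA)) ⟨
        Δ² r (pick B sB ++ pick A sA ++ [])
          ≈⟨ Skew-block (Δ²-skew r) (pick B sB) (pick A sA) [] ⟩
        sg (length (pick B sB) ℕ.* length (pick A sA)) * Δ² r (pick A sA ++ pick B sB ++ [])
          ≡⟨ ≡.cong₂ (λ k l → sg k * Δ² r (pick A sA ++ l))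
               (≡.cong₂ ℕ._*_ (≡.trans (length-pick B sB) ∣B∣) (≡.trans (length-pick A sA) ∣A∣)) (++-identityʳ (pick B sB)) ⟩
        sg (r ℕ.* r) * Δ² r (pick A sA ++ pick B sB) ∎

    -- Each sum is a signed Laplace expansion of one side of `Δ²-exchange`; in the sum over W the
    -- roles of A and B are interchanged.
    exchanged-sums :
      Σ (allSubsets n) (λ W → when (W ⊆ᵇ A ∧ (∣ W ∣ ≡ᵇ ∣ Y ∣)) (when (⊥ ⊆ᵇ W ∧ W ⊆ᵇ U) (exchanged col B A Y W)))
        ≈ Σ (allSubsets n) (λ V → when (V ⊆ᵇ B ∧ (∣ V ∣ ≡ᵇ ∣ U ∣)) (when (Y ⊆ᵇ V ∧ V ⊆ᵇ B) (exchanged col A B U V)))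
    exchanged-sums = begin
      sum-over-W
        ≈⟨ signed-trans {m = ∣ Y ∣ ℕ.+ inversions B Y ℕ.+ rowSign r ℕ.+ swapSign ℕ.+ rowSign r}
             (signed-trans {m = ∣ Y ∣ ℕ.+ inversions B Y ℕ.+ rowSign r ℕ.+ swapSign}
             (signed-trans {m = ∣ Y ∣ ℕ.+ inversions B Y ℕ.+ rowSign r}
             (signed-trans {m = ∣ Y ∣ ℕ.+ inversions B Y}
               (signed-sym {n = ∣ Y ∣ ℕ.+ inversions B Y} (partial-exchange-sum col B A Y ⊥ U ∣B∣ Y⊆B (⊥⊆ᵇ A)))
               (Δ⊛Δ r _))
               Δ²-exchange)
               (signed-sym {n = rowSign r} (Δ⊛Δ r _)))
               (partial-exchange-sum col A B U Y B ∣A∣ U⊆A Y⊆B) ⟩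
      sg (∣ Y ∣ ℕ.+ inversions B Y ℕ.+ rowSign r ℕ.+ swapSign ℕ.+ rowSign r ℕ.+ (∣ U ∣ ℕ.+ inversions A U)) * sum-over-V
        -- Every contribution occurs twice, apart from r², |A ─ U| and |U|; the last two add up to
        -- r, and r² + r is even.
        ≡⟨ ≡.cong (λ k → sg k * sum-over-V) (≡.trans
             (rearrange (∣ Y ∣) (inversions B Y) (rowSign r) (r ℕ.* r) (inversions A U) (∣ A ─ U ∣) (∣ U ∣))
             (≡.cong (λ k → half ℕ.+ half ℕ.+ (r ℕ.* r ℕ.+ k)) (≡.trans (∣p─q∣+∣q∣≡∣p∣ A U U⊆A) ∣A∣))) ⟩
      sg (half ℕ.+ half ℕ.+ (r ℕ.* r ℕ.+ r)) * sum-over-V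
        ≈⟨ trans (*-congʳ (sg-even half r)) (*-identityˡ _) ⟩
      sum-over-V ∎
      where
      sum-over-W = Σ (allSubsets n) (λ W → when (W ⊆ᵇ A ∧ (∣ W ∣ ≡ᵇ ∣ Y ∣)) (when (⊥ ⊆ᵇ W ∧ W ⊆ᵇ U) (exchanged col B A Y W)))
      sum-over-V = Σ (allSubsets n) (λ V → when (V ⊆ᵇ B ∧ (∣ V ∣ ≡ᵇ ∣ U ∣)) (when (Y ⊆ᵇ V ∧ V ⊆ᵇ B) (exchanged col A B U V)))
      swapSign = ∣ Y ∣ ℕ.+ inversions B Y ℕ.+ r ℕ.* r ℕ.+ (inversions A U ℕ.+ ∣ A ─ U ∣)
      half = ∣ Y ∣ ℕ.+ inversions B Y ℕ.+ rowSign r ℕ.+ inversions A U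
      rearrange : ∀ y iB s rr iA d u → y ℕ.+ iB ℕ.+ s ℕ.+ (y ℕ.+ iB ℕ.+ rr ℕ.+ (iA ℕ.+ d)) ℕ.+ s ℕ.+ (u ℕ.+ iA)
        ≡ (y ℕ.+ iB ℕ.+ s ℕ.+ iA) ℕ.+ (y ℕ.+ iB ℕ.+ s ℕ.+ iA) ℕ.+ (rr ℕ.+ (d ℕ.+ u))
      rearrange = ℕ-RingSolver.solve-∀

  -- The exchange identity for `μ`

  module _ {r n : ℕ} (M : Fin r → Fin n → K) (A B : Subset n) where

    column : Fin n → Column r
    column j i = M i j

    det-replace : ∀ (A U V : Subset n) → U ⊆ᵇ A ≡ true → ∣ V ∣ ≡ ∣ U ∣ →
      detL r (colsOf M (replace (elems A) (elems U) (elems V))) ≈ Δ r (substitute A U column (pick V column))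
    det-replace A U V U⊆A eq = trans (detL≈Δ r _) (reflexive (≡.cong (Δ r) (≡.trans
      (≡.cong₂ (λ as xs → map column (replace as xs (elems V))) (elems≡pick A) (elems≡pick U))
      (≡.trans
        (replace-pick A U id column (elems V) id U⊆A (≡.trans (≡.cong length (elems≡pick V)) (≡.trans (length-pick V id) eq)))
        (≡.cong (substitute A U column) (map-elems V column))))))

    μ≈exchanged : ∀ (U V : Subset n) → U ⊆ᵇ A ≡ true → V ⊆ᵇ B ≡ true → ∣ V ∣ ≡ ∣ U ∣ → μ M A B U V ≈ exchanged column A B U V
    μ≈exchanged U V U⊆A V⊆B eq = *-cong (det-replace A U V U⊆A eq) (det-replace B V U V⊆B (≡.sym eq))

    module _ (∣A∣ : ∣ A ∣ ≡ r) (∣B∣ : ∣ B ∣ ≡ r) where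

      -- An element of V ∩ A lies in B, hence not in U ⊆ A ─ B; its column stays in `A ─ U` and
      -- enters a second time with V.
      exchanged-common : ∀ (U V : Subset n) → U ⊆ᵇ (A ─ B) ≡ true → ∣ V ∣ ≡ ∣ U ∣ → V ⊆ᵇ B ≡ true → V ⊆ᵇ (B ─ A) ≡ false →
        exchanged column A B U V ≈ 0#
      exchanged-common U V U⊆ eq V⊆B V⊈ = trans (*-congʳ (begin
        Δ r (substitute A U column (pick V column))
          ≡⟨ ≡.cong (Δ r) (++-identityʳ _) ⟨
        Δ r (substitute A U column (pick V column) ++ [])
          ≈⟨ signed-sym {n = inversions A U} (sort A U column (pick V column) [] (Δ-skew r) (⊆ᵇ-trans U (A ─ B) A U⊆ (─⊆ᵇ A B)) (≡.trans (length-pick V column) eq)) ⟩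
        sg (inversions A U) * Δ r (pick (A ─ U) column ++ pick V column ++ [])
          ≈⟨ *-congˡ repeated ⟩
        sg (inversions A U) * 0#
          ≈⟨ zeroʳ _ ⟩
        0# ∎)) (zeroˡ _)
        where
        repeated : Δ r (pick (A ─ U) column ++ pick V column ++ []) ≈ 0#
        repeated with meets-removed V A B V⊆B V⊈
        ... | j , j∈V , j∈A , j∈B
            with pick-split V column j j∈V | pick-split (A ─ U) column j (lookup-─⁺ A U j j∈A λ j∈U →
              contradiction (≡.trans (≡.sym j∈B) (proj₂ (lookup-─ A B j (⊆ᵇ-lookup U (A ─ B) j U⊆ j∈U)))) λ ())
        ... | pre′ , post′ , e′ | pre , post , e = trans
          (reflexive (≡.cong (Δ r) (≡.trans (≡.cong₂ _++_ e (≡.trans (++-identityʳ _) e′))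
            (≡.trans (++-assoc pre (column j ∷ post) _) (≡.cong (λ l → pre ++ column j ∷ l) (≡.sym (++-assoc post pre′ _)))))))
          (begin
            Δ r (pre ++ column j ∷ (post ++ pre′) ++ column j ∷ post′)
              ≈⟨ repeated-zero (Δ-skew r) (Δ-repeat r) pre (column j) (post ++ pre′) post′ ⟩
            0# ∎)

      exchange-superset : ∀ (U Y : Subset n) → U ⊆ᵇ (A ─ B) ≡ true → Y ⊆ᵇ (B ─ A) ≡ true →
        Σ (allSubsets n) (λ V → when (V ⊆ᵇ (B ─ A) ∧ (∣ V ∣ ≡ᵇ ∣ U ∣) ∧ Y ⊆ᵇ V) (μ M A B U V))
          ≈ Σ (allSubsets n) (λ W → when (W ⊆ᵇ U ∧ (∣ W ∣ ≡ᵇ ∣ Y ∣)) (μ M A B W Y))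
      exchange-superset U Y U⊆ Y⊆ = begin
        Σ (allSubsets n) (λ V → when (V ⊆ᵇ (B ─ A) ∧ (∣ V ∣ ≡ᵇ ∣ U ∣) ∧ Y ⊆ᵇ V) (μ M A B U V))
          ≈⟨ Σ-cong (allSubsets n) V-term ⟨
        Σ (allSubsets n) (λ V → when (V ⊆ᵇ B ∧ (∣ V ∣ ≡ᵇ ∣ U ∣)) (when (Y ⊆ᵇ V ∧ V ⊆ᵇ B) (exchanged column A B U V)))
          ≈⟨ exchanged-sums column A B U Y ∣A∣ ∣B∣ U⊆A Y⊆B ⟨
        Σ (allSubsets n) (λ W → when (W ⊆ᵇ A ∧ (∣ W ∣ ≡ᵇ ∣ Y ∣)) (when (⊥ ⊆ᵇ W ∧ W ⊆ᵇ U) (exchanged column B A Y W)))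
          ≈⟨ Σ-cong (allSubsets n) W-term ⟩
        Σ (allSubsets n) (λ W → when (W ⊆ᵇ U ∧ (∣ W ∣ ≡ᵇ ∣ Y ∣)) (μ M A B W Y)) ∎
        where
        U⊆A = ⊆ᵇ-trans U (A ─ B) A U⊆ (─⊆ᵇ A B)
        Y⊆B = ⊆ᵇ-trans Y (B ─ A) B Y⊆ (─⊆ᵇ B A)
        V-term : ∀ V → when (V ⊆ᵇ B ∧ (∣ V ∣ ≡ᵇ ∣ U ∣)) (when (Y ⊆ᵇ V ∧ V ⊆ᵇ B) (exchanged column A B U V))
          ≈ when (V ⊆ᵇ (B ─ A) ∧ (∣ V ∣ ≡ᵇ ∣ U ∣) ∧ Y ⊆ᵇ V) (μ M A B U V)
        V-term V with V ⊆ᵇ (B ─ A) in e₁ | V ⊆ᵇ B in e₂ | ∣ V ∣ ≡ᵇ ∣ U ∣ in e₃ | Y ⊆ᵇ V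
        ... | true  | false | _     | _     = contradiction (≡.trans (≡.sym e₂) (⊆ᵇ-trans V (B ─ A) B e₁ (─⊆ᵇ B A))) λ ()
        ... | true  | true  | true  | true  = sym (μ≈exchanged U V U⊆A e₂ (≡ᵇ-true e₃))
        ... | true  | true  | true  | false = refl
        ... | true  | true  | false | _     = refl
        ... | false | false | _     | _     = refl
        ... | false | true  | false | _     = refl
        ... | false | true  | true  | false = refl
        ... | false | true  | true  | true  = exchanged-common U V U⊆ (≡ᵇ-true e₃) e₂ e₁
        W-term : ∀ W → when (W ⊆ᵇ A ∧ (∣ W ∣ ≡ᵇ ∣ Y ∣)) (when (⊥ ⊆ᵇ W ∧ W ⊆ᵇ U) (exchanged column B A Y W))
          ≈ when (W ⊆ᵇ U ∧ (∣ W ∣ ≡ᵇ ∣ Y ∣)) (μ M A B W Y)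
        W-term W rewrite ⊥⊆ᵇ W with W ⊆ᵇ U in e₁ | W ⊆ᵇ A in e₂ | ∣ W ∣ ≡ᵇ ∣ Y ∣ in e₃
        ... | true  | false | _     = contradiction (≡.trans (≡.sym e₂) (⊆ᵇ-trans W U A e₁ U⊆A)) λ ()
        -- The expansion over W starts from B, so the two determinants of `μ` appear in the opposite
        -- order.
        ... | true  | true  | true  = trans (*-comm _ _) (sym (μ≈exchanged W Y e₂ Y⊆B (≡.sym (≡ᵇ-true {∣ W ∣} e₃))))
        ... | true  | true  | false = refl
        ... | false | true  | true  = refl
        ... | false | true  | false = refl
        ... | false | false | _     = refl

-- Generalized binomial coefficients and Vandermonde's identity

module Arithmetic {a ℓ} (F : Field a ℓ) where
  open Field F hiding (zero) renaming (Carrier to K)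
  open FieldOps F
  open ExteriorForms commutativeRing using (sg)
  open SubsetSums F
  open import Algebra.Properties.Ring ring
  open import Algebra.Properties.CommutativeSemigroup *-commutativeSemigroup using (x∙yz≈y∙xz)
  open import Relation.Binary.Reasoning.Setoid setoid

  ℕ→F-+ : ∀ m n → ℕ→F (m ℕ.+ n) ≈ ℕ→F m + ℕ→F n
  ℕ→F-+ zero    n = sym (+-identityˡ _)
  ℕ→F-+ (suc m) n = trans (+-congˡ (ℕ→F-+ m n)) (sym (+-assoc _ _ _))

  ℤ→F-neg : ∀ z → ℤ→F (ℤ.- z) ≈ - ℤ→F z
  ℤ→F-neg (+ zero)  = sym -0#≈0#
  ℤ→F-neg (+ suc m) = refl
  ℤ→F-neg -[1+ m ]  = sym (-‿involutive _)

  ℤ→F-negOnePow : ∀ k n → ℤ→F (negOnePow k ℤ.* (+ n)) ≈ sg k * ℕ→F n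
  ℤ→F-negOnePow zero    n = trans (reflexive (≡.cong ℤ→F (ℤ.*-identityˡ (+ n)))) (sym (*-identityˡ _))
  ℤ→F-negOnePow (suc k) n = begin
    ℤ→F (ℤ.- negOnePow k ℤ.* + n)     ≡⟨ ≡.cong ℤ→F (ℤ.neg-distribˡ-* (negOnePow k) (+ n)) ⟨
    ℤ→F (ℤ.- (negOnePow k ℤ.* + n))   ≈⟨ ℤ→F-neg (negOnePow k ℤ.* + n) ⟩
    - ℤ→F (negOnePow k ℤ.* + n)       ≈⟨ -‿cong (ℤ→F-negOnePow k n) ⟩
    - (sg k * ℕ→F n)                  ≈⟨ -‿distribˡ-* _ _ ⟩
    - sg k * ℕ→F n                    ∎

  binom : ℤ → ℕ → K
  binom z k = ℤ→F (gbinom z k)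

  binom-zero : ∀ z → binom z 0 ≈ 1#
  binom-zero (+ m)    = +-identityʳ 1#
  binom-zero -[1+ m ] = trans (ℤ→F-negOnePow 0 1) (trans (*-identityˡ _) (+-identityʳ 1#))

  ℕ→F-pascal : ∀ m k → ℕ→F (suc m C suc k) ≈ ℕ→F (m C suc k) + ℕ→F (m C k)
  ℕ→F-pascal m k = trans (reflexive (≡.cong ℕ→F (≡.sym (nCk+nC[k+1]≡[n+1]C[k+1] m k)))) (trans (ℕ→F-+ (m C k) _) (+-comm _ _))

  -- The two clauses of `gbinom` meet at z = -1, where two alternating signs cancel to 0; on either
  -- side the rule reduces to Pascal's rule in ℕ.
  binom-pascal : ∀ z k → binom (ℤ.suc z) (suc k) ≈ binom z (suc k) + binom z k
  binom-pascal (+ m)        k = ℕ→F-pascal m k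
  binom-pascal -[1+ zero ]  k = begin
    0#
      ≈⟨ -‿inverseˡ (sg k * 1#) ⟨
    - (sg k * 1#) + sg k * 1#
      ≈⟨ +-cong (-‿distribˡ-* _ _) refl ⟩
    sg (suc k) * 1# + sg k * 1#
      ≈⟨ +-cong (column (suc k)) (column k) ⟨
    binom -[1+ 0 ] (suc k) + binom -[1+ 0 ] k ∎
    where
    column : ∀ k → binom -[1+ 0 ] k ≈ sg k * 1#
    column k = trans (ℤ→F-negOnePow k _) (*-congˡ (trans (reflexive (≡.cong ℕ→F (≡.trans (≡.cong (_C k) (ℕ.+-identityʳ k)) (C-self k)))) (+-identityʳ 1#)))
      where
      C-self : ∀ k → k C k ≡ 1
      C-self zero    = ≡.refl
      C-self (suc k) = ≡.trans (≡.sym (nCk+nC[k+1]≡[n+1]C[k+1] k k))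
        (≡.cong₂ ℕ._+_ (C-self k) (k>n⇒nCk≡0 (ℕ.n<1+n k)))
  binom-pascal -[1+ suc m ] k = begin
    binom -[1+ m ] (suc k)
      ≈⟨ ℤ→F-negOnePow (suc k) _ ⟩
    s * ℕ→F (N C suc k)
      ≈⟨ +-identityʳ _ ⟨
    s * ℕ→F (N C suc k) + 0#
      ≈⟨ +-congˡ (-‿inverseˡ (sg k * ℕ→F (N C k))) ⟨
    s * ℕ→F (N C suc k) + (- (sg k * ℕ→F (N C k)) + sg k * ℕ→F (N C k))
      ≈⟨ +-assoc _ _ _ ⟨
    s * ℕ→F (N C suc k) + - (sg k * ℕ→F (N C k)) + sg k * ℕ→F (N C k)
      ≈⟨ +-congʳ (trans (+-congˡ (-‿distribˡ-* _ _)) (sym (distribˡ s _ _))) ⟩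
    s * (ℕ→F (N C suc k) + ℕ→F (N C k)) + sg k * ℕ→F (N C k)
      ≈⟨ +-congʳ (*-congˡ (ℕ→F-pascal N k)) ⟨
    s * ℕ→F (suc N C suc k) + sg k * ℕ→F (N C k)
      ≡⟨ ≡.cong (λ M → s * ℕ→F (suc M C suc k) + sg k * ℕ→F (M C k)) (ℕ.+-suc k m) ⟨
    s * ℕ→F (suc (k ℕ.+ suc m) C suc k) + sg k * ℕ→F ((k ℕ.+ suc m) C k)
      ≈⟨ +-cong (ℤ→F-negOnePow (suc k) _) (ℤ→F-negOnePow k _) ⟨
    binom -[1+ suc m ] (suc k) + binom -[1+ suc m ] k ∎
    where
    s = sg (suc k)
    N = suc (k ℕ.+ m)

  ∑ : ℕ → (ℕ → K) → K
  ∑ n = Σ (upTo n)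

  ∑-suc : ∀ n f → ∑ (suc n) f ≡ f 0 + ∑ n (f ∘ suc)
  ∑-suc n f = ≡.cong (λ s → f 0 + s) (go id n)
    where
    go : ∀ (g : ℕ → ℕ) n → Σ (applyUpTo (suc ∘ g) n) f ≡ Σ (applyUpTo g n) (f ∘ suc)
    go g zero    = ≡.refl
    go g (suc n) = ≡.cong (λ s → f (suc (g 0)) + s) (go (g ∘ suc) n)

  ∑-cong : ∀ n {f g} → (∀ k → k < n → f k ≈ g k) → ∑ n f ≈ ∑ n g
  ∑-cong zero    p = refl
  ∑-cong (suc n) {f} {g} p = begin
    ∑ (suc n) f               ≡⟨ ∑-suc n f ⟩
    f 0 + ∑ n (f ∘ suc)       ≈⟨ +-cong (p 0 z<s) (∑-cong n λ k k<n → p (suc k) (s<s k<n)) ⟩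
    g 0 + ∑ n (g ∘ suc)       ≡⟨ ∑-suc n g ⟨
    ∑ (suc n) g               ∎

  ∑-zero : ∀ n {f} → (∀ k → k < n → f k ≈ 0#) → ∑ n f ≈ 0#
  ∑-zero n p = trans (∑-cong n p) (Σ-zero (upTo n) λ _ → refl)

  ∑-last : ∀ n f → ∑ (suc n) f ≈ ∑ n f + f n
  ∑-last zero    f = +-comm _ _
  ∑-last (suc n) f = begin
    ∑ (suc (suc n)) f                       ≡⟨ ∑-suc (suc n) f ⟩
    f 0 + ∑ (suc n) (f ∘ suc)               ≈⟨ +-congˡ (∑-last n (f ∘ suc)) ⟩
    f 0 + (∑ n (f ∘ suc) + f (suc n))       ≈⟨ +-assoc _ _ _ ⟨
    f 0 + ∑ n (f ∘ suc) + f (suc n)         ≡⟨ ≡.cong (λ s → s + f (suc n)) (∑-suc n f) ⟨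
    ∑ (suc n) f + f (suc n)                 ∎

  ∑-single : ∀ n {f} j → j < n → (∀ k → k < n → k ≢ j → f k ≈ 0#) → ∑ n f ≈ f j
  ∑-single (suc n) {f} zero    _ p = trans (reflexive (∑-suc n f))
    (trans (+-congˡ (∑-zero n λ k k<n → p (suc k) (s<s k<n) λ ())) (+-identityʳ _))
  ∑-single (suc n) {f} (suc j) (s<s j<n) p = trans (reflexive (∑-suc n f))
    (trans (+-cong (p 0 z<s λ ()) (∑-single n j j<n λ k k<n ne → p (suc k) (s<s k<n) (ne ∘ ℕ.suc-injective))) (+-identityˡ _))

  -- Both sides run over the triangle k + i ≤ y; the induction splits off the row k = 0.
  ∑-triangle : ∀ y (f : ℕ → ℕ → K) →
    ∑ (suc y) (λ k → ∑ (suc (y ∸ k)) (f k)) ≈ ∑ (suc y) (λ i → ∑ (suc (y ∸ i)) (λ k → f k i))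
  ∑-triangle zero    f = refl
  ∑-triangle (suc y) f = begin
    ∑ (suc (suc y)) (λ k → ∑ (suc (suc y ∸ k)) (f k))
      ≡⟨ ∑-suc (suc y) _ ⟩
    ∑ (suc (suc y)) (f 0) + ∑ (suc y) (λ k → ∑ (suc (y ∸ k)) (f (suc k)))
      ≈⟨ +-congˡ (∑-triangle y (f ∘ suc)) ⟩
    ∑ (suc (suc y)) (f 0) + ∑ (suc y) (λ i → ∑ (suc (y ∸ i)) (λ k → f (suc k) i))
      ≈⟨ +-congˡ (+-identityʳ _) ⟨
    ∑ (suc (suc y)) (f 0) + (∑ (suc y) (λ i → ∑ (suc (y ∸ i)) (λ k → f (suc k) i)) + 0#)
      -- For i ≤ y the length `suc y ∸ i` is `suc (y ∸ i)`; the added column i = `suc y` is empty.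
      ≈⟨ +-congˡ (+-cong (∑-cong (suc y) λ i i≤y → reflexive (≡.cong (λ m → ∑ m (λ k → f (suc k) i)) (ℕ.+-∸-assoc 1 (s≤s⁻¹ i≤y))))
                         (reflexive (≡.cong (λ m → ∑ m (λ k → f (suc k) (suc y))) (ℕ.n∸n≡0 y)))) ⟨
    ∑ (suc (suc y)) (f 0) + (∑ (suc y) (λ i → ∑ (suc y ∸ i) (λ k → f (suc k) i)) + ∑ (y ∸ y) (λ k → f (suc k) (suc y)))
      ≈⟨ +-congˡ (∑-last (suc y) (λ i → ∑ (suc y ∸ i) (λ k → f (suc k) i))) ⟨
    ∑ (suc (suc y)) (f 0) + ∑ (suc (suc y)) (λ i → ∑ (suc y ∸ i) (λ k → f (suc k) i))
      ≈⟨ Σ-+ (upTo (suc (suc y))) _ _ ⟨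
    ∑ (suc (suc y)) (λ i → f 0 i + ∑ (suc y ∸ i) (λ k → f (suc k) i))
      ≈⟨ Σ-cong (upTo (suc (suc y))) (λ i → reflexive (∑-suc (suc y ∸ i) (λ k → f k i))) ⟨
    ∑ (suc (suc y)) (λ i → ∑ (suc (suc y ∸ i)) (λ k → f k i)) ∎

  -- binom z (t − f), which is 0 if t < f.
  binom-∸ : ℤ → ℕ → ℕ → K
  binom-∸ z zero    t       = binom z t
  binom-∸ z (suc f) zero    = 0#
  binom-∸ z (suc f) (suc t) = binom-∸ z f t

  binom-∸-< : ∀ z f t → t < f → binom-∸ z f t ≈ 0#
  binom-∸-< z (suc f) zero    _         = refl
  binom-∸-< z (suc f) (suc t) (s<s t<f) = binom-∸-< z f t t<f

  binom-∸-+ : ∀ z f q → binom-∸ z f (f ℕ.+ q) ≡ binom z q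
  binom-∸-+ z zero    q = ≡.refl
  binom-∸-+ z (suc f) q = binom-∸-+ z f q

  -- The number `f` of prescribed elements is carried along because removing one of the `m` free
  -- elements produces it: `supersets-suc` splits the sum into the cases f = 0 and f = 1, and
  -- Pascal's rule joins their values.
  vandermonde : ∀ m f z t →
    ∑ (suc t) (λ k → binom z (t ∸ k) * ℕ→F (supersets m f k)) ≈ binom-∸ (z ℤ.+ + m) f t
  vandermonde m (suc f) z zero    = trans (+-identityʳ _) (zeroʳ _)
  vandermonde m (suc f) z (suc t) = begin
    _                 ≡⟨ ∑-suc (suc t) _ ⟩
    _ * 0# + _        ≈⟨ +-cong (zeroʳ _) (vandermonde m f z t) ⟩
    0# + _            ≈⟨ +-identityˡ _ ⟩
    _                 ∎
  vandermonde zero    zero z t = begin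
    _                                     ≡⟨ ∑-suc t _ ⟩
    binom z t * (1# + 0#) + ∑ t (λ k → binom z (t ∸ suc k) * 0#)
      ≈⟨ +-cong (trans (*-congˡ (+-identityʳ 1#)) (*-identityʳ _)) (∑-zero t λ _ _ → zeroʳ _) ⟩
    binom z t + 0#                        ≈⟨ +-identityʳ _ ⟩
    binom z t                             ≡⟨ ≡.cong (λ w → binom w t) (ℤ.+-identityʳ z) ⟨
    binom (z ℤ.+ + 0) t                   ∎
  vandermonde (suc m) zero z zero    = begin
    _                                     ≈⟨ +-identityʳ _ ⟩
    binom z 0 * (1# + 0#)                 ≈⟨ trans (*-congˡ (+-identityʳ 1#)) (*-identityʳ _) ⟩
    binom z 0                             ≈⟨ trans (binom-zero z) (sym (binom-zero (z ℤ.+ + suc m))) ⟩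
    binom (z ℤ.+ + suc m) 0               ∎
  vandermonde (suc m) zero z (suc t) = begin
    ∑ (suc (suc t)) (λ k → binom z (suc t ∸ k) * ℕ→F (suc m C k))
      ≈⟨ Σ-cong (upTo (suc (suc t))) (λ k → trans
           (*-congˡ (trans (reflexive (≡.cong ℕ→F (supersets-suc m 0 k))) (ℕ→F-+ (m C k) _))) (distribˡ _ _ _)) ⟩
    ∑ (suc (suc t)) (λ k → binom z (suc t ∸ k) * ℕ→F (m C k) + binom z (suc t ∸ k) * ℕ→F (supersets m 1 k))
      ≈⟨ Σ-+ (upTo (suc (suc t))) _ _ ⟩
    ∑ (suc (suc t)) (λ k → binom z (suc t ∸ k) * ℕ→F (m C k))
      + ∑ (suc (suc t)) (λ k → binom z (suc t ∸ k) * ℕ→F (supersets m 1 k))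
      ≈⟨ +-cong (vandermonde m 0 z (suc t)) (vandermonde m 1 z (suc t)) ⟩
    binom (z ℤ.+ + m) (suc t) + binom (z ℤ.+ + m) t
      ≈⟨ binom-pascal (z ℤ.+ + m) t ⟨
    binom (ℤ.suc (z ℤ.+ + m)) (suc t)
      ≡⟨ ≡.cong (λ w → binom w (suc t)) (shift z (+ m)) ⟩
    binom (z ℤ.+ + suc m) (suc t) ∎
    where
    shift : ∀ z w → ℤ.1ℤ ℤ.+ (z ℤ.+ w) ≡ z ℤ.+ (ℤ.1ℤ ℤ.+ w)
    shift = ℤ-RingSolver.solve-∀

  shift-below : ∀ w i d → binom-∸ (+ suc (i ℕ.+ d) ℤ.- + i ℤ.- + 1) w (w ℕ.+ suc (i ℕ.+ d) ∸ i) ≈ 0#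
  shift-below w i d = begin
    binom-∸ (+ suc (i ℕ.+ d) ℤ.- + i ℤ.- + 1) w (w ℕ.+ suc (i ℕ.+ d) ∸ i)
      ≡⟨ ≡.cong₂ (λ z t → binom-∸ z w t) (cancel (+ i) (+ d))
           (≡.trans (ℕ.+-∸-assoc w (ℕ.m≤n⇒m≤1+n (ℕ.m≤m+n i d))) (≡.cong (w ℕ.+_)
             (≡.trans (ℕ.+-∸-assoc 1 (ℕ.m≤m+n i d)) (≡.cong suc (ℕ.m+n∸m≡n i d))))) ⟩
    binom-∸ (+ d) w (w ℕ.+ suc d)
      ≡⟨ binom-∸-+ (+ d) w (suc d) ⟩
    ℕ→F (d C suc d)
      ≡⟨ ≡.cong ℕ→F (k>n⇒nCk≡0 (ℕ.n<1+n d)) ⟩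
    0# ∎
    where
    cancel : ∀ i d → (ℤ.1ℤ ℤ.+ (i ℤ.+ d)) ℤ.- i ℤ.- ℤ.1ℤ ≡ d
    cancel = ℤ-RingSolver.solve-∀

  -- The value is binom(j - i - 1, j - i). For i < j the upper index is nonnegative and one less
  -- than the lower; for i > j the lower index is negative.
  shift-off-diagonal : ∀ w j i → i ≤ w ℕ.+ j → i ≢ j → binom-∸ (+ j ℤ.- + i ℤ.- + 1) w (w ℕ.+ j ∸ i) ≈ 0#
  shift-off-diagonal w j i i≤y i≢j with ℕ.<-cmp i j
  ... | tri< i<j _ _ = ≡.subst (λ j → binom-∸ (+ j ℤ.- + i ℤ.- + 1) w (w ℕ.+ j ∸ i) ≈ 0#)
          (ℕ.m+[n∸m]≡n i<j) (shift-below w i (j ∸ suc i))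
  ... | tri≈ _ eq _  = contradiction eq i≢j
  ... | tri> _ _ i>j = binom-∸-< _ w (w ℕ.+ j ∸ i) (ℕ.+-cancelʳ-< i (w ℕ.+ j ∸ i) w
          (≡.subst (_< w ℕ.+ i) (≡.sym (ℕ.m∸n+n≡m i≤y)) (ℕ.+-monoʳ-< w i>j)))

  shift-diagonal : ∀ w j → binom-∸ (+ j ℤ.- + j ℤ.- + 1) w (w ℕ.+ j ∸ j) ≈ 1#
  shift-diagonal w j = begin
    binom-∸ (+ j ℤ.- + j ℤ.- + 1) w (w ℕ.+ j ∸ j)
      ≡⟨ ≡.cong (binom-∸ (+ j ℤ.- + j ℤ.- + 1) w) (≡.trans (ℕ.m+n∸n≡m w j) (≡.sym (ℕ.+-identityʳ w))) ⟩
    binom-∸ (+ j ℤ.- + j ℤ.- + 1) w (w ℕ.+ 0)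
      ≡⟨ binom-∸-+ _ w 0 ⟩
    binom (+ j ℤ.- + j ℤ.- + 1) 0
      ≈⟨ binom-zero (+ j ℤ.- + j ℤ.- + 1) ⟩
    1# ∎

  -- Here a = |X ─ W|, j = |W ∩ X|, w = |W ─ X| and m = |(A ─ B) ─ X ─ W|, so that the upper index of
  -- the generalized binomial coefficient is z i = j − m − i − 1.
  coefficient-sum : ∀ a j w m p q (inv : ℕ → K) → p ≡ j ℕ.+ q → q ≤ a →
    inv j * ℕ→F (a C q) ≈ 1# → ∀ (z : ℕ → ℤ) → (∀ i → z i ℤ.+ + m ≡ + j ℤ.- + i ℤ.- + 1) →
    ∑ (suc (w ℕ.+ j)) (λ k → ∑ (suc (w ℕ.+ j ∸ k)) λ i →
      binom (z i) (w ℕ.+ j ∸ k ∸ i) * inv i * (ℕ→F (supersets a j p) * ℕ→F (supersets m w k))) ≈ 1#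
  coefficient-sum a j w m p q inv ≡.refl q≤a inverse z z+m = begin
    ∑ (suc y) (λ k → ∑ (suc (y ∸ k)) λ i → binom (z i) (y ∸ k ∸ i) * inv i * (P * N k))
      -- The denominator depends on `i` only, so with `i` outermost each inner sum over `k` is a
      -- Vandermonde sum.
      ≈⟨ ∑-triangle y _ ⟩
    ∑ (suc y) (λ i → ∑ (suc (y ∸ i)) λ k → binom (z i) (y ∸ k ∸ i) * inv i * (P * N k))
      ≈⟨ Σ-cong (upTo (suc y)) inner ⟩
    ∑ (suc y) (λ i → inv i * P * binom-∸ (+ j ℤ.- + i ℤ.- + 1) w (y ∸ i))
      ≈⟨ ∑-single (suc y) j (s≤s (ℕ.m≤n+m j w)) (λ i i≤y i≢j → trans (*-congˡ (shift-off-diagonal w j i (s≤s⁻¹ i≤y) i≢j)) (zeroʳ _)) ⟩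
    inv j * P * binom-∸ (+ j ℤ.- + j ℤ.- + 1) w (y ∸ j)
      ≈⟨ trans (*-congˡ (shift-diagonal w j)) (*-identityʳ _) ⟩
    inv j * P
      ≡⟨ ≡.cong (λ k → inv j * ℕ→F k) (supersets-+ a j q) ⟩
    inv j * ℕ→F (a C q)
      ≈⟨ inverse ⟩
    1# ∎
    where
    y = w ℕ.+ j
    P = ℕ→F (supersets a j (j ℕ.+ q))
    N : ℕ → K
    N k = ℕ→F (supersets m w k)
    rearrange : ∀ b v p n → b * v * (p * n) ≈ v * p * (b * n)
    rearrange b v p n = begin
      b * v * (p * n)    ≈⟨ *-assoc _ _ _ ⟩
      b * (v * (p * n))  ≈⟨ *-congˡ (*-assoc _ _ _) ⟨
      b * (v * p * n)    ≈⟨ x∙yz≈y∙xz _ _ _ ⟩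
      v * p * (b * n)    ∎
    inner : ∀ i → ∑ (suc (y ∸ i)) (λ k → binom (z i) (y ∸ k ∸ i) * inv i * (P * N k))
      ≈ inv i * P * binom-∸ (+ j ℤ.- + i ℤ.- + 1) w (y ∸ i)
    inner i = begin
      ∑ (suc (y ∸ i)) (λ k → binom (z i) (y ∸ k ∸ i) * inv i * (P * N k))
        ≈⟨ Σ-cong (upTo (suc (y ∸ i))) (λ k → trans (rearrange _ _ _ _)
             (*-congˡ (*-congʳ (reflexive (≡.cong (binom (z i)) (∸-swap k)))))) ⟩
      ∑ (suc (y ∸ i)) (λ k → inv i * P * (binom (z i) (y ∸ i ∸ k) * N k))
        ≈⟨ Σ-*ˡ _ (upTo (suc (y ∸ i))) _ ⟩
      inv i * P * ∑ (suc (y ∸ i)) (λ k → binom (z i) (y ∸ i ∸ k) * N k)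
        ≈⟨ *-congˡ (vandermonde m w (z i) (y ∸ i)) ⟩
      inv i * P * binom-∸ (z i ℤ.+ + m) w (y ∸ i)
        ≡⟨ ≡.cong (λ u → inv i * P * binom-∸ u w (y ∸ i)) (z+m i) ⟩
      inv i * P * binom-∸ (+ j ℤ.- + i ℤ.- + 1) w (y ∸ i) ∎
      where
      ∸-swap : ∀ k → y ∸ k ∸ i ≡ y ∸ i ∸ k
      ∸-swap k = ≡.trans (ℕ.∸-+-assoc y k i) (≡.trans (≡.cong (y ∸_) (ℕ.+-comm k i)) (≡.sym (ℕ.∸-+-assoc y i k)))

-- Counting the sets between W and A ─ B

module Counting {a ℓ} (F : Field a ℓ) where
  open Field F hiding (zero) renaming (Carrier to K)
  open FieldOps F
  open SubsetSums F
  open Arithmetic F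
  open import Relation.Binary.Reasoning.Setoid setoid

  when-false : ∀ {b x} → b ≡ false → when b x ≈ 0#
  when-false ≡.refl = refl

  -- Choices inside and outside `X` are independent. Going through D, an element of W is prescribed
  -- and any other is free; a free one is split by `supersets-suc` in the factor to which it
  -- belongs.
  superset-count : ∀ {n} (D X W : Subset n) → X ⊆ᵇ D ≡ true → W ⊆ᵇ D ≡ true → ∀ p k →
    Σ (allSubsets n) (λ U → when (U ⊆ᵇ D ∧ W ⊆ᵇ U ∧ (∣ U ∩ X ∣ ≡ᵇ p) ∧ (∣ U ─ X ∣ ≡ᵇ k)) 1#)
      ≈ ℕ→F (supersets ∣ X ─ W ∣ ∣ W ∩ X ∣ p) * ℕ→F (supersets ∣ (D ─ X) ─ W ∣ ∣ W ─ X ∣ k)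
  superset-count []            []            []            s t zero    zero    = trans (+-congʳ (sym (*-identityˡ _))) (trans (+-cong (*-cong (sym (+-identityʳ _)) (sym (+-identityʳ _))) refl) (+-identityʳ _))
  superset-count []            []            []            s t zero    (suc k) = trans (+-identityʳ _) (sym (zeroʳ _))
  superset-count []            []            []            s t (suc p) k       = trans (+-identityʳ _) (sym (zeroˡ _))
  superset-count {suc n} (outside ∷ D) (outside ∷ X) (outside ∷ W) s t p k = begin
    _       ≈⟨ Σ-allSubsets-suc n _ ⟩
    _ + _   ≈⟨ +-cong (Σ-zero (allSubsets n) λ _ → refl) (superset-count D X W s t p k) ⟩
    0# + _  ≈⟨ +-identityˡ _ ⟩
    _       ∎
  superset-count {suc n} (inside ∷ D)  (inside ∷ X)  (inside ∷ W)  s t p k = begin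
    _       ≈⟨ Σ-allSubsets-suc n _ ⟩
    _ + _   ≈⟨ +-cong (included p) (Σ-zero (allSubsets n) λ U → when-false (∧-zeroʳ (U ⊆ᵇ D))) ⟩
    _ + 0#  ≈⟨ +-identityʳ _ ⟩
    _       ∎
    where
    included : ∀ p → Σ (allSubsets n) (λ U → when (U ⊆ᵇ D ∧ W ⊆ᵇ U ∧ (suc ∣ U ∩ X ∣ ≡ᵇ p) ∧ (∣ U ─ X ∣ ≡ᵇ k)) 1#)
      ≈ ℕ→F (supersets ∣ X ─ W ∣ (suc ∣ W ∩ X ∣) p) * ℕ→F (supersets ∣ (D ─ X) ─ W ∣ ∣ W ─ X ∣ k)
    included zero    = trans
      (Σ-zero (allSubsets n) λ U → when-false (≡.trans (≡.cong (U ⊆ᵇ D ∧_) (∧-zeroʳ (W ⊆ᵇ U))) (∧-zeroʳ (U ⊆ᵇ D))))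
      (sym (zeroˡ _))
    included (suc p) = superset-count D X W s t p k
  superset-count {suc n} (inside ∷ D)  (inside ∷ X)  (outside ∷ W) s t p k = begin
    _       ≈⟨ Σ-allSubsets-suc n _ ⟩
    _ + _   ≈⟨ +-cong (included p) (superset-count D X W s t p k) ⟩
    _ + _   ≈⟨ distribʳ _ _ _ ⟨
    _ * _   ≈⟨ *-congʳ (trans (+-comm _ _) (sym (ℕ→F-+ (supersets ∣ X ─ W ∣ ∣ W ∩ X ∣ p) _))) ⟩
    _ * _   ≡⟨ ≡.cong (λ c → ℕ→F c * _) (supersets-suc ∣ X ─ W ∣ ∣ W ∩ X ∣ p) ⟨
    _       ∎
    where
    included : ∀ p → Σ (allSubsets n) (λ U → when (U ⊆ᵇ D ∧ W ⊆ᵇ U ∧ (suc ∣ U ∩ X ∣ ≡ᵇ p) ∧ (∣ U ─ X ∣ ≡ᵇ k)) 1#)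
      ≈ ℕ→F (supersets ∣ X ─ W ∣ (suc ∣ W ∩ X ∣) p) * ℕ→F (supersets ∣ (D ─ X) ─ W ∣ ∣ W ─ X ∣ k)
    included zero    = trans
      (Σ-zero (allSubsets n) λ U → when-false (≡.trans (≡.cong (U ⊆ᵇ D ∧_) (∧-zeroʳ (W ⊆ᵇ U))) (∧-zeroʳ (U ⊆ᵇ D))))
      (sym (zeroˡ _))
    included (suc p) = superset-count D X W s t p k
  superset-count {suc n} (inside ∷ D)  (outside ∷ X) (inside ∷ W)  s t p k = begin
    _       ≈⟨ Σ-allSubsets-suc n _ ⟩
    _ + _   ≈⟨ +-cong (included k) (Σ-zero (allSubsets n) λ U → when-false (∧-zeroʳ (U ⊆ᵇ D))) ⟩
    _ + 0#  ≈⟨ +-identityʳ _ ⟩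
    _       ∎
    where
    included : ∀ k → Σ (allSubsets n) (λ U → when (U ⊆ᵇ D ∧ W ⊆ᵇ U ∧ (∣ U ∩ X ∣ ≡ᵇ p) ∧ (suc ∣ U ─ X ∣ ≡ᵇ k)) 1#)
      ≈ ℕ→F (supersets ∣ X ─ W ∣ ∣ W ∩ X ∣ p) * ℕ→F (supersets ∣ (D ─ X) ─ W ∣ (suc ∣ W ─ X ∣) k)
    included zero    = trans
      (Σ-zero (allSubsets n) λ U → when-false (≡.trans (≡.cong (λ b → U ⊆ᵇ D ∧ W ⊆ᵇ U ∧ b) (∧-zeroʳ (∣ U ∩ X ∣ ≡ᵇ p))) (≡.trans (≡.cong (U ⊆ᵇ D ∧_) (∧-zeroʳ (W ⊆ᵇ U))) (∧-zeroʳ (U ⊆ᵇ D)))))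
      (sym (zeroʳ _))
    included (suc k) = superset-count D X W s t p k
  superset-count {suc n} (inside ∷ D)  (outside ∷ X) (outside ∷ W) s t p k = begin
    _       ≈⟨ Σ-allSubsets-suc n _ ⟩
    _ + _   ≈⟨ +-cong (included k) (superset-count D X W s t p k) ⟩
    _ + _   ≈⟨ distribˡ _ _ _ ⟨
    _ * _   ≈⟨ *-congˡ (trans (+-comm _ _) (sym (ℕ→F-+ (supersets ∣ (D ─ X) ─ W ∣ ∣ W ─ X ∣ k) _))) ⟩
    _ * _   ≡⟨ ≡.cong (λ c → _ * ℕ→F c) (supersets-suc ∣ (D ─ X) ─ W ∣ ∣ W ─ X ∣ k) ⟨
    _       ∎
    where
    included : ∀ k → Σ (allSubsets n) (λ U → when (U ⊆ᵇ D ∧ W ⊆ᵇ U ∧ (∣ U ∩ X ∣ ≡ᵇ p) ∧ (suc ∣ U ─ X ∣ ≡ᵇ k)) 1#)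
      ≈ ℕ→F (supersets ∣ X ─ W ∣ ∣ W ∩ X ∣ p) * ℕ→F (supersets ∣ (D ─ X) ─ W ∣ (suc ∣ W ─ X ∣) k)
    included zero    = trans
      (Σ-zero (allSubsets n) λ U → when-false (≡.trans (≡.cong (λ b → U ⊆ᵇ D ∧ W ⊆ᵇ U ∧ b) (∧-zeroʳ (∣ U ∩ X ∣ ≡ᵇ p))) (≡.trans (≡.cong (U ⊆ᵇ D ∧_) (∧-zeroʳ (W ⊆ᵇ U))) (∧-zeroʳ (U ⊆ᵇ D)))))
      (sym (zeroʳ _))
    included (suc k) = superset-count D X W s t p k

  sum-over-empty : ∀ {n} (D : Subset n) (f : Subset n → K) →
    Σ (allSubsets n) (λ W → when (W ⊆ᵇ D ∧ (∣ W ∣ ≡ᵇ 0)) (f W)) ≈ f ⊥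
  sum-over-empty []      f = +-identityʳ _
  sum-over-empty {suc n} (x ∷ D) f = begin
    _             ≈⟨ Σ-allSubsets-suc n _ ⟩
    _ + _         ≈⟨ +-cong (Σ-zero (allSubsets n) λ W → when-false (∧-zeroʳ (does ((inside ∷ W) ⊆? (x ∷ D))))) (sum-over-empty D (f ∘ (outside ∷_))) ⟩
    0# + f ⊥      ≈⟨ +-identityˡ _ ⟩
    f ⊥           ∎

-- Coefficient of each μ(W, Y) in the right-hand side

module Expansion {a ℓ} (F : Field a ℓ) where
  open Field F hiding (zero) renaming (Carrier to K)
  open FieldOps F
  open SubsetSums F
  open ExchangeIdentity F
  open Arithmetic F
  open Counting F
  open import Algebra.Properties.CommutativeSemigroup *-commutativeSemigroup using (x∙yz≈y∙xz)
  open import Relation.Binary.Reasoning.Setoid setoid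

  module _ {r n : ℕ} (M : Fin r → Fin n → K) (A B X Y : Subset n)
    (∣A∣ : ∣ A ∣ ≡ r) (∣B∣ : ∣ B ∣ ≡ r) (X⊆ : X ⊆ᵇ (A ─ B) ≡ true) (Y⊆ : Y ⊆ᵇ (B ─ A) ≡ true) (p : ℕ) where

    D E : Subset n
    D = A ─ B
    E = B ─ A

    subsets : List (Subset n)
    subsets = allSubsets n

    eligible : Subset n → K
    eligible W = when (W ⊆ᵇ D ∧ (∣ W ∣ ≡ᵇ ∣ Y ∣)) (μ M A B W Y)

    extensions : ℕ → Subset n → K
    extensions k W = Σ subsets λ U → when (U ⊆ᵇ D ∧ W ⊆ᵇ U ∧ (∣ U ∩ X ∣ ≡ᵇ p) ∧ (∣ U ─ X ∣ ≡ᵇ k)) 1#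

    -- As |D| = |E|, the only V ⊆ E of size |D| is E itself, which contains both Y and ∅. So Y may
    -- be replaced by ∅, and going back through the identity leaves only W = ∅.
    sum-eligible : Σ subsets eligible ≈ μ M A B ⊥ ⊥
    sum-eligible = begin
      Σ subsets (λ W → when (W ⊆ᵇ D ∧ (∣ W ∣ ≡ᵇ ∣ Y ∣)) (μ M A B W Y))
        ≈⟨ exchange-superset M A B ∣A∣ ∣B∣ D Y (⊆ᵇ-complete D D ⊆-refl) Y⊆ ⟨
      Σ subsets (λ V → when (V ⊆ᵇ E ∧ (∣ V ∣ ≡ᵇ ∣ D ∣) ∧ Y ⊆ᵇ V) (μ M A B D V))
        ≈⟨ Σ-cong subsets full ⟩
      Σ subsets (λ V → when (V ⊆ᵇ E ∧ (∣ V ∣ ≡ᵇ ∣ D ∣) ∧ ⊥ ⊆ᵇ V) (μ M A B D V))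
        ≈⟨ exchange-superset M A B ∣A∣ ∣B∣ D ⊥ (⊆ᵇ-complete D D ⊆-refl) (⊥⊆ᵇ E) ⟩
      Σ subsets (λ W → when (W ⊆ᵇ D ∧ (∣ W ∣ ≡ᵇ ∣ ⊥ {n} ∣)) (μ M A B W ⊥))
        ≡⟨ ≡.cong (λ s → Σ subsets (λ W → when (W ⊆ᵇ D ∧ (∣ W ∣ ≡ᵇ s)) (μ M A B W ⊥))) (∣⊥∣≡0 n) ⟩
      Σ subsets (λ W → when (W ⊆ᵇ D ∧ (∣ W ∣ ≡ᵇ 0)) (μ M A B W ⊥))
        ≈⟨ sum-over-empty D (λ W → μ M A B W ⊥) ⟩
      μ M A B ⊥ ⊥ ∎
      where
      ∣D∣≡∣E∣ : ∣ D ∣ ≡ ∣ E ∣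
      ∣D∣≡∣E∣ = ℕ.+-cancelʳ-≡ r ∣ D ∣ ∣ E ∣ (≡.trans (≡.cong (∣ D ∣ ℕ.+_) (≡.sym ∣B∣))
        (≡.trans (∣A─B∣+∣B∣≡∣B─A∣+∣A∣ A B) (≡.cong (∣ E ∣ ℕ.+_) ∣A∣)))
      full : ∀ V → when (V ⊆ᵇ E ∧ (∣ V ∣ ≡ᵇ ∣ D ∣) ∧ Y ⊆ᵇ V) (μ M A B D V)
        ≈ when (V ⊆ᵇ E ∧ (∣ V ∣ ≡ᵇ ∣ D ∣) ∧ ⊥ ⊆ᵇ V) (μ M A B D V)
      full V with V ⊆ᵇ E in e₁ | ∣ V ∣ ≡ᵇ ∣ D ∣ in e₂
      ... | false | _     = refl
      ... | true  | false = refl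
      ... | true  | true  with ⊆ᵇ-antisym-size V E e₁ (≡.trans (≡ᵇ-true {∣ V ∣} e₂) ∣D∣≡∣E∣)
      ...   | ≡.refl rewrite Y⊆ | ⊥⊆ᵇ E = refl

    inner-sum : ℕ → K
    inner-sum k = Σ subsets λ U → Σ subsets λ V →
      if ⌊ U ⊆? D ⌋ ∧ ⌊ ∣ U ∣ ℕ.≟ (p ℕ.+ k) ⌋ ∧ ⌊ ∣ U ∩ X ∣ ℕ.≟ p ⌋
         ∧ ⌊ V ⊆? E ⌋ ∧ ⌊ ∣ V ∣ ℕ.≟ (p ℕ.+ k) ⌋ ∧ ⌊ Y ⊆? V ⌋
      then μ M A B U V else 0#

    -- After the exchange the summand depends on U only through conditions; with W outermost, the
    -- sum over U is a mere count.
    inner-sum≈ : ∀ k → inner-sum k ≈ Σ subsets λ W → eligible W * extensions k W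
    inner-sum≈ k = begin
      inner-sum k
        ≈⟨ Σ-cong subsets over-V ⟩
      Σ subsets (λ U → when (U ⊆ᵇ D ∧ (∣ U ∣ ≡ᵇ p ℕ.+ k) ∧ (∣ U ∩ X ∣ ≡ᵇ p)) (Σ subsets λ W → when (W ⊆ᵇ U ∧ (∣ W ∣ ≡ᵇ ∣ Y ∣)) (μ M A B W Y)))
        ≈⟨ Σ-cong subsets over-W ⟩
      Σ subsets (λ U → Σ subsets λ W → eligible W * when (U ⊆ᵇ D ∧ W ⊆ᵇ U ∧ (∣ U ∩ X ∣ ≡ᵇ p) ∧ (∣ U ─ X ∣ ≡ᵇ k)) 1#)
        ≈⟨ Σ-swap subsets subsets _ ⟩
      Σ subsets (λ W → Σ subsets λ U → eligible W * when (U ⊆ᵇ D ∧ W ⊆ᵇ U ∧ (∣ U ∩ X ∣ ≡ᵇ p) ∧ (∣ U ─ X ∣ ≡ᵇ k)) 1#)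
        ≈⟨ Σ-cong subsets (λ W → Σ-*ˡ (eligible W) subsets _) ⟩
      Σ subsets (λ W → eligible W * extensions k W) ∎
      where
      over-V : ∀ U → (Σ subsets λ V →
          if ⌊ U ⊆? D ⌋ ∧ ⌊ ∣ U ∣ ℕ.≟ (p ℕ.+ k) ⌋ ∧ ⌊ ∣ U ∩ X ∣ ℕ.≟ p ⌋
             ∧ ⌊ V ⊆? E ⌋ ∧ ⌊ ∣ V ∣ ℕ.≟ (p ℕ.+ k) ⌋ ∧ ⌊ Y ⊆? V ⌋
          then μ M A B U V else 0#)
        ≈ when (U ⊆ᵇ D ∧ (∣ U ∣ ≡ᵇ p ℕ.+ k) ∧ (∣ U ∩ X ∣ ≡ᵇ p)) (Σ subsets λ W → when (W ⊆ᵇ U ∧ (∣ W ∣ ≡ᵇ ∣ Y ∣)) (μ M A B W Y))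
      over-V U rewrite isYes≗does (U ⊆? D) | isYes≗does (∣ U ∣ ℕ.≟ (p ℕ.+ k)) | isYes≗does (∣ U ∩ X ∣ ℕ.≟ p)
        with U ⊆ᵇ D in e₁ | ∣ U ∣ ≡ᵇ p ℕ.+ k in e₂ | ∣ U ∩ X ∣ ≡ᵇ p
      ... | false | _     | _     = Σ-zero subsets λ _ → refl
      ... | true  | false | _     = Σ-zero subsets λ _ → refl
      ... | true  | true  | false = Σ-zero subsets λ _ → refl
      ... | true  | true  | true  = trans (Σ-cong subsets sizes) (exchange-superset M A B ∣A∣ ∣B∣ U Y e₁ Y⊆)
        where
        sizes : ∀ V → when (⌊ V ⊆? E ⌋ ∧ ⌊ ∣ V ∣ ℕ.≟ (p ℕ.+ k) ⌋ ∧ ⌊ Y ⊆? V ⌋) (μ M A B U V)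
          ≈ when (V ⊆ᵇ E ∧ (∣ V ∣ ≡ᵇ ∣ U ∣) ∧ Y ⊆ᵇ V) (μ M A B U V)
        sizes V rewrite isYes≗does (V ⊆? E) | isYes≗does (∣ V ∣ ℕ.≟ (p ℕ.+ k)) | isYes≗does (Y ⊆? V) | ≡ᵇ-true {∣ U ∣} e₂ = refl
      over-W : ∀ U → when (U ⊆ᵇ D ∧ (∣ U ∣ ≡ᵇ p ℕ.+ k) ∧ (∣ U ∩ X ∣ ≡ᵇ p)) (Σ subsets λ W → when (W ⊆ᵇ U ∧ (∣ W ∣ ≡ᵇ ∣ Y ∣)) (μ M A B W Y))
        ≈ Σ subsets λ W → eligible W * when (U ⊆ᵇ D ∧ W ⊆ᵇ U ∧ (∣ U ∩ X ∣ ≡ᵇ p) ∧ (∣ U ─ X ∣ ≡ᵇ k)) 1#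
      over-W U rewrite split-size U X p k with U ⊆ᵇ D in e₁ | (∣ U ∩ X ∣ ≡ᵇ p) ∧ (∣ U ─ X ∣ ≡ᵇ k)
      ... | false | _     = sym (Σ-zero subsets λ W → zeroʳ _)
      ... | true  | false = sym (Σ-zero subsets λ W → trans (*-congˡ (when-false (∧-zeroʳ (W ⊆ᵇ U)))) (zeroʳ _))
      ... | true  | true  = Σ-cong subsets term
        where
        term : ∀ W → when (W ⊆ᵇ U ∧ (∣ W ∣ ≡ᵇ ∣ Y ∣)) (μ M A B W Y) ≈ eligible W * when (W ⊆ᵇ U ∧ true) 1#
        term W with W ⊆ᵇ U in e₂
        ... | false = sym (zeroʳ _)
        ... | true rewrite ⊆ᵇ-trans W U D e₂ e₁ = sym (*-identityʳ _)

    coefficient : ℕ → ℕ → K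
    coefficient k i = ℤ→F (gbinom (+ ∣ X ∪ Y ∣ ℤ.- + ∣ A ─ B ∣ ℤ.- + i ℤ.- + 1) (∣ Y ∣ ∸ k ∸ i))
        * (ℕ→F ((∣ X ∣ ∸ i) C (∣ X ∣ ∸ p)) ⁻¹)

    rhs≈ : rhs M A B X Y p ≈ Σ subsets λ W →
      eligible W * ∑ (suc ∣ Y ∣) (λ k → ∑ (suc (∣ Y ∣ ∸ k)) (λ i → coefficient k i * extensions k W))
    rhs≈ = begin
      ∑ (suc ∣ Y ∣) (λ k → ∑ (suc (∣ Y ∣ ∸ k)) (λ i → coefficient k i * inner-sum k))
        ≈⟨ Σ-cong (upTo (suc ∣ Y ∣)) (λ k → trans (Σ-cong (upTo (suc (∣ Y ∣ ∸ k))) (term k))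
             (trans (Σ-swap (upTo (suc (∣ Y ∣ ∸ k))) subsets _) (Σ-cong subsets λ W → Σ-*ˡ (eligible W) (upTo (suc (∣ Y ∣ ∸ k))) _))) ⟩
      ∑ (suc ∣ Y ∣) (λ k → Σ subsets λ W → eligible W * ∑ (suc (∣ Y ∣ ∸ k)) (λ i → coefficient k i * extensions k W))
        ≈⟨ Σ-swap (upTo (suc ∣ Y ∣)) subsets _ ⟩
      Σ subsets (λ W → ∑ (suc ∣ Y ∣) (λ k → eligible W * ∑ (suc (∣ Y ∣ ∸ k)) (λ i → coefficient k i * extensions k W)))
        ≈⟨ Σ-cong subsets (λ W → Σ-*ˡ (eligible W) (upTo (suc ∣ Y ∣)) _) ⟩
      Σ subsets (λ W → eligible W * ∑ (suc ∣ Y ∣) (λ k → ∑ (suc (∣ Y ∣ ∸ k)) (λ i → coefficient k i * extensions k W))) ∎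
      where
      term : ∀ k i → coefficient k i * inner-sum k ≈ Σ subsets λ W → eligible W * (coefficient k i * extensions k W)
      term k i = begin
        coefficient k i * inner-sum k
          ≈⟨ *-congˡ (inner-sum≈ k) ⟩
        coefficient k i * Σ subsets (λ W → eligible W * extensions k W)
          ≈⟨ Σ-*ˡ (coefficient k i) subsets _ ⟨
        Σ subsets (λ W → coefficient k i * (eligible W * extensions k W))
          ≈⟨ Σ-cong subsets (λ W → x∙yz≈y∙xz _ _ _) ⟩
        Σ subsets (λ W → eligible W * (coefficient k i * extensions k W)) ∎

    module _ (∣Y∣≤p : ∣ Y ∣ ≤ p) (p≤∣X∣ : p ≤ ∣ X ∣)
      (invertible : ∀ i → i ≤ ∣ Y ∣ → ¬ (ℕ→F ((∣ X ∣ ∸ i) C (∣ X ∣ ∸ p)) ≈ 0#)) where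

      total-coefficient : ∀ W → W ⊆ᵇ D ≡ true → ∣ W ∣ ≡ ∣ Y ∣ →
        ∑ (suc ∣ Y ∣) (λ k → ∑ (suc (∣ Y ∣ ∸ k)) (λ i → coefficient k i * extensions k W)) ≈ 1#
      total-coefficient W W⊆ eq = begin
        ∑ (suc ∣ Y ∣) (λ k → ∑ (suc (∣ Y ∣ ∸ k)) (λ i → coefficient k i * extensions k W))
          ≈⟨ Σ-cong (upTo (suc ∣ Y ∣)) (λ k → Σ-cong (upTo (suc (∣ Y ∣ ∸ k))) λ i → *-congˡ (superset-count D X W X⊆ W⊆ p k)) ⟩
        summed ∣ Y ∣
          ≡⟨ ≡.cong summed y≡ ⟩
        summed (w ℕ.+ j)
          ≈⟨ coefficient-sum s j w m p q inv p≡ q≤s inverse z z+m ⟩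
        1# ∎
        where
        s = ∣ X ─ W ∣
        j = ∣ W ∩ X ∣
        w = ∣ W ─ X ∣
        m = ∣ (D ─ X) ─ W ∣
        q = p ∸ j
        z : ℕ → ℤ
        z i = + ∣ X ∪ Y ∣ ℤ.- + ∣ D ∣ ℤ.- + i ℤ.- + 1
        inv : ℕ → K
        inv i = ℕ→F ((∣ X ∣ ∸ i) C (∣ X ∣ ∸ p)) ⁻¹
        summed : ℕ → K
        summed y = ∑ (suc y) (λ k → ∑ (suc (y ∸ k)) λ i →
          binom (z i) (y ∸ k ∸ i) * inv i * (ℕ→F (supersets s j p) * ℕ→F (supersets m w k)))
        x≡ : ∣ X ∣ ≡ s ℕ.+ j
        x≡ = ≡.trans (≡.sym (∣p∩q∣+∣p─q∣≡∣p∣ X W))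
          (≡.trans (≡.cong (λ S → ∣ S ∣ ℕ.+ s) (∩-comm X W)) (ℕ.+-comm j s))
        y≡ : ∣ Y ∣ ≡ w ℕ.+ j
        y≡ = ≡.trans (≡.sym eq) (≡.trans (≡.sym (∣p∩q∣+∣p─q∣≡∣p∣ W X)) (ℕ.+-comm j w))
        j≤y : j ≤ ∣ Y ∣
        j≤y = ≡.subst (j ≤_) (≡.sym y≡) (ℕ.m≤n+m j w)
        j≤p : j ≤ p
        j≤p = ℕ.≤-trans j≤y ∣Y∣≤p
        p≡ : p ≡ j ℕ.+ q
        p≡ = ≡.sym (ℕ.m+[n∸m]≡n j≤p)
        q≤s : q ≤ s
        q≤s = ≡.subst (q ≤_) (≡.trans (≡.cong (_∸ j) x≡) (ℕ.m+n∸n≡m s j)) (ℕ.∸-monoˡ-≤ j p≤∣X∣)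
        -- With |X| = s + j and p = j + q, the denominator at i = j is binom(s, s - q), which equals
        -- the number binom(s, q) of ways to complete W ∩ X inside X.
        index : (∣ X ∣ ∸ j) C (∣ X ∣ ∸ p) ≡ s C q
        index = ≡.trans
          (≡.cong₂ _C_ (≡.trans (≡.cong (_∸ j) x≡) (ℕ.m+n∸n≡m s j))
            (≡.trans (≡.cong₂ _∸_ (≡.trans x≡ (ℕ.+-comm s j)) p≡) (ℕ.[m+n]∸[m+o]≡n∸o j s q)))
          (≡.sym (nCk≡nC[n∸k] q≤s))
        inverse : inv j * ℕ→F (s C q) ≈ 1#
        inverse = trans (*-comm _ _) (trans (*-congʳ (reflexive (≡.cong ℕ→F (≡.sym index))))
          (⁻¹-inverse _ (invertible j j≤y)))
        -- |X ∪ Y| - |D| = (s + j) + (w + j) - (s + j + w + m) = j - m, because X and Y are disjoint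
        -- and |Y| = |W| = w + j.
        z+m : ∀ i → z i ℤ.+ + m ≡ + j ℤ.- + i ℤ.- + 1
        z+m i = ≡.trans
          (≡.cong₂ (λ u v → + u ℤ.- + v ℤ.- + i ℤ.- + 1 ℤ.+ + m)
            (≡.trans (∣p∪q∣-disjoint X Y A B X⊆ Y⊆) (≡.cong₂ ℕ._+_ x≡ y≡))
            (≡.trans (∣D∣-split D X W X⊆ W⊆) (≡.cong (λ x → x ℕ.+ w ℕ.+ m) x≡)))
          (cancel (+ s) (+ j) (+ w) (+ m) (+ i))
          where
          cancel : ∀ s j w m i → (s ℤ.+ j) ℤ.+ (w ℤ.+ j) ℤ.- (s ℤ.+ j ℤ.+ w ℤ.+ m) ℤ.- i ℤ.- ℤ.1ℤ ℤ.+ m ≡ j ℤ.- i ℤ.- ℤ.1ℤ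
          cancel = ℤ-RingSolver.solve-∀

      μ≈rhs : μ M A B ⊥ ⊥ ≈ rhs M A B X Y p
      μ≈rhs = sym (begin
        rhs M A B X Y p
          ≈⟨ rhs≈ ⟩
        Σ subsets (λ W → eligible W * ∑ (suc ∣ Y ∣) (λ k → ∑ (suc (∣ Y ∣ ∸ k)) (λ i → coefficient k i * extensions k W)))
          ≈⟨ Σ-cong subsets collapse ⟩
        Σ subsets eligible
          ≈⟨ sum-eligible ⟩
        μ M A B ⊥ ⊥ ∎)
        where
        collapse : ∀ W → eligible W * ∑ (suc ∣ Y ∣) (λ k → ∑ (suc (∣ Y ∣ ∸ k)) (λ i → coefficient k i * extensions k W)) ≈ eligible W
        collapse W with W ⊆ᵇ D in e₁ | ∣ W ∣ ≡ᵇ ∣ Y ∣ in e₂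
        ... | false | _     = zeroˡ _
        ... | true  | false = zeroˡ _
        ... | true  | true  = trans (*-congˡ (total-coefficient W e₁ (≡ᵇ-true {∣ W ∣} e₂))) (*-identityʳ _)

theorem5p1 : ∀ {a ℓ : Level} (F : Field a ℓ) (c : ℕ) → FieldOps.HasCharacteristic F c →
    ∀ {r n : ℕ} (M : Fin r → Fin n → Field.Carrier F) (A B X Y : Subset n) →
    ∣ A ∣ ≡ r → ∣ B ∣ ≡ r → X ⊆ (A ─ B) → Y ⊆ (B ─ A) →
    (p : ℕ) → ∣ Y ∣ ≤ p → p ≤ ∣ X ∣ →
    (c ≡ 0 ⊎ (∀ (i : ℕ) → i ≤ ∣ Y ∣ → ¬ (c ∣ ((∣ X ∣ ∸ i) C (∣ X ∣ ∸ p))))) →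
    Field._≈_ F (FieldOps.μ F M A B ⊥ ⊥) (FieldOps.rhs F M A B X Y p)
theorem5p1 F c char M A B X Y ∣A∣ ∣B∣ X⊆ Y⊆ p ∣Y∣≤p p≤∣X∣ hyp =
  Expansion.μ≈rhs F M A B X Y ∣A∣ ∣B∣ (⊆ᵇ-complete X (A ─ B) X⊆) (⊆ᵇ-complete Y (B ─ A) Y⊆) p ∣Y∣≤p p≤∣X∣
    (λ i i≤∣Y∣ zero → not-divisible hyp i i≤∣Y∣ (proj₁ (char _) zero))
  where
  not-divisible : (c ≡ 0 ⊎ (∀ i → i ≤ ∣ Y ∣ → ¬ (c ∣ ((∣ X ∣ ∸ i) C (∣ X ∣ ∸ p))))) →
    ∀ i → i ≤ ∣ Y ∣ → ¬ (c ∣ ((∣ X ∣ ∸ i) C (∣ X ∣ ∸ p)))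
  -- Divisibility by 0 means being 0, whereas the binomial coefficient is positive since i ≤ |Y| ≤
  -- p.
  not-divisible (inj₁ ≡.refl) i i≤∣Y∣ 0∣ =
    C-positive (∣ X ∣ ∸ i) (∣ X ∣ ∸ p) (ℕ.∸-monoʳ-≤ ∣ X ∣ (ℕ.≤-trans i≤∣Y∣ ∣Y∣≤p)) (0∣⇒≡0 0∣)
  not-divisible (inj₂ h) = h
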